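{- Let $(\alpha,\beta)\in\Delta_K$ and $n\in\mathbb{Z}_{\ge0}$. Let $M_n=A_{\varepsilon_0}\cdots A_{\varepsilon_{n-1}}S=\begin{pmatrix}p''_n&p'_n&p_n\\ q''_n&q'_n&q_n\\ r''_n&r'_n&r_n\end{pmatrix}$, where $\varepsilon_k=\varepsilon(T^k(\alpha,\beta))$ (and $M_0=S$), and let $\delta_n(\alpha,\beta)$ be the set of interior points of the triangle in $\mathbb{R}^2$ with vertices $(q_n/p_n,r_n/p_n)$, $(q'_n/p'_n,r'_n/p'_n)$, $(q''_n/p''_n,r''_n/p''_n)$. Then $(\alpha,\beta)\in\delta_n(\alpha,\beta)$.
   Context: Let $K\subset\mathbb{R}$ be a real cubic number field, $N=N_{K/\mathbb{Q}}$ its norm. Fix $r=p/q$ with $p,q$ positive coprime integers and $3\nmid p$. Let $\Delta_K=\{(\alpha,\beta)\in K^2:\ 1,\alpha,\beta \text{ linearly independent over }\mathbb{Q},\ \alpha,\beta>0,\ \alpha+\beta<1\}$ and $Ind=\{(i,j): i,j\in\{0,1,2\},\ i\neq j\}$. Let $\Delta=\{(x,y)\in\mathbb{R}^2: x,y\ge 0,\ x+y\le 1\}$ and $\triangle(1,2)=\{(x,y)\in\Delta: x\ge y\}$, $\triangle(2,1)=\{x\le y\}$, $\triangle(0,1)=\{2x+y-1\le 0\}$, $\triangle(1,0)=\{2x+y-1\ge 0\}$, $\triangle(0,2)=\{x+2y-1\le0\}$, $\triangle(2,0)=\{x+2y-1\ge 0\}$ (all subsets of $\Delta$). Maps $T_{(i,j)}:\triangle(i,j)\to\Delta$: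 $T_{(1,2)}(x,y)=(\frac{x-y}{1-y},\frac{y}{1-y})$, $T_{(2,1)}(x,y)=(\frac{x}{1-x},\frac{y-x}{1-x})$, $T_{(0,1)}(x,y)=(\frac{x}{1-x},\frac{y}{1-x})$, $T_{(1,0)}(x,y)=(\frac{2x+y-1}{x+y},\frac{y}{x+y})$, $T_{(0,2)}(x,y)=(\frac{x}{1-y},\frac{y}{1-y})$, $T_{(2,0)}(x,y)=(\frac{x}{x+y},\frac{x+2y-1}{x+y})$. For $(\alpha,\beta)\in\Delta_K$ put $\gamma=1-\alpha-\beta$ and $v_{\{1,2\}}=\frac{\alpha^r\beta^r}{|N(\alpha)N(\beta)|}$, $v_{\{0,1\}}=\frac{\alpha^r\gamma^r}{|N(\alpha)N(\gamma)|}$, $v_{\{0,2\}}=\frac{\beta^r\gamma^r}{|N(\beta)N(\gamma)|}$; the maximum is attained at a unique pair $\{i_0,j_0\}$. $\varepsilon(\alpha,\beta)$ is the ordered pair $(i,j)\in Ind$ with $\{i,j\}=\{i_0,j_0\}$ and $(\alpha,\beta)\in\triangle(i,j)$, and $T(\alpha,\beta)=T_{\varepsilon(\alpha,\beta)}(\alpha,\beta)$ (a map $\Delta_K\to\Delta_K$). Matrices: $A_{(1,2)}=\begin{pmatrix}1&0&1\\0&1&1\\0&0&1\end{pmatrix}$, $A_{(2,1)}=\begin{pmatrix}1&1&0\\0&1&0\\0&1&1\end{pmatrix}$, $A_{(0,1)}=\begin{pmatrix}1&1&0\\0&1&0\\0&0&1\end{pmatrix}$, $A_{(1,0)}=\begin{pmatrix}2&-1&-1\\1&0&-1\\0&0&1\end{pmatrix}$,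 $A_{(0,2)}=\begin{pmatrix}1&0&1\\0&1&0\\0&0&1\end{pmatrix}$, $A_{(2,0)}=\begin{pmatrix}2&-1&-1\\0&1&0\\1&-1&0\end{pmatrix}$, $S=\begin{pmatrix}1&1&1\\0&1&0\\0&0&1\end{pmatrix}$. -}

module Defs where

open import Algebra.Apartness.Bundles using (HeytingField; HeytingCommutativeRing)
open import Algebra.Bundles using (CommutativeRing)
open import Algebra.Morphism.Structures using (module RingMorphisms)
import Algebra.Apartness.Properties.HeytingCommutativeRing as HeytingProperties
import Algebra.Properties.CommutativeSemiring.Exp as Exp
import Algebra.Properties.Semiring.Sum as Summation
import Algebra.Properties.Ring as RingProperties
import Algebra.Solver.Ring as RingSolver
open import Algebra.Solver.Ring.AlmostCommutativeRing using (fromCommutativeRing; _-Raw-AlmostCommutative⟶_)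
open import Data.Empty using (⊥-elim)
open import Data.Fin.Base using (Fin; zero; suc; combine; remQuot)
open import Data.Fin.Patterns using (0F; 1F; 2F)
open import Data.Integer.Base as ℤ using (ℤ; 0ℤ; 1ℤ; -1ℤ; +_)
import Data.Integer.Properties as ℤ
open import Data.List.Base using (foldr; applyUpTo)
open import Data.Maybe.Base using (Maybe; just; nothing)
open import Data.Nat.Base as ℕ using (ℕ; zero; suc)
open import Data.Nat.GeneralisedArithmetic using (iterate)
open import Data.Product.Base using (∃; ∃-syntax; Σ-syntax; _×_; _,_; proj₁; proj₂; uncurry)
open import Data.Rational.Base as ℚ using (ℚ; 0ℚ; 1ℚ; ∣_∣)
import Data.Rational.Properties as ℚ
import Data.Rational.Unnormalised.Base as ℚᵘ
import Data.Rational.Unnormalised.Properties as ℚᵘ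
open import Data.Sum.Base as Sum using (_⊎_; inj₁; inj₂; [_,_]′)
open import Data.Vec.Base as Vec using (Vec)
open import Data.Vec.Functional using (Vector; []; _∷_)
open import Function.Base using (_∘_; case_of_)
open import Function.Bundles using (_⇔_; mk⇔; Equivalence)
open import Level using (_⊔_) renaming (suc to lsuc)
open import Relation.Binary.Core using (Rel)
open import Relation.Binary.Definitions using (tri<; tri≈; tri>)
open import Relation.Binary.PropositionalEquality as ≡ using (_≡_; _≢_)
open import Relation.Binary.Structures using (IsStrictPartialOrder)
open import Relation.Nullary.Decidable.Core using (yes; no)
open import Relation.Nullary.Negation.Core using (¬_)
open import Relation.Unary using (Pred; _∈_)

open Summation ℤ.+-*-semiring using () renaming (sum to ℤ-sum)

ℤ→ℚ : ℤ → ℚ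
ℤ→ℚ z = z ℚ./ 1

module ℤ→ℚ-Homomorphism where
  toℚᵘ-ℤ→ℚ : ∀ z → ℚ.toℚᵘ (ℤ→ℚ z) ℚᵘ.≃ ℚᵘ.mkℚᵘ z 0
  toℚᵘ-ℤ→ℚ z = ℚ.toℚᵘ-fromℚᵘ (ℚᵘ.mkℚᵘ z 0)

  +-homo : ∀ y z → ℤ→ℚ (y ℤ.+ z) ≡ ℤ→ℚ y ℚ.+ ℤ→ℚ z
  +-homo y z = ℚ.toℚᵘ-injective (begin
    ℚ.toℚᵘ (ℤ→ℚ (y ℤ.+ z))                    ≈⟨ toℚᵘ-ℤ→ℚ (y ℤ.+ z) ⟩
    ℚᵘ.mkℚᵘ (y ℤ.+ z) 0                       ≡⟨ ≡.cong (λ x → ℚᵘ.mkℚᵘ x 0) (≡.cong₂ ℤ._+_ (ℤ.*-identityʳ y) (ℤ.*-identityʳ z)) ⟨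
    ℚᵘ.mkℚᵘ y 0 ℚᵘ.+ ℚᵘ.mkℚᵘ z 0              ≈⟨ ℚᵘ.+-cong (toℚᵘ-ℤ→ℚ y) (toℚᵘ-ℤ→ℚ z) ⟨
    ℚ.toℚᵘ (ℤ→ℚ y) ℚᵘ.+ ℚ.toℚᵘ (ℤ→ℚ z)        ≈⟨ ℚ.toℚᵘ-homo-+ (ℤ→ℚ y) (ℤ→ℚ z) ⟨
    ℚ.toℚᵘ (ℤ→ℚ y ℚ.+ ℤ→ℚ z)                  ∎)
    where open ℚᵘ.≃-Reasoning

  *-homo : ∀ y z → ℤ→ℚ (y ℤ.* z) ≡ ℤ→ℚ y ℚ.* ℤ→ℚ z
  *-homo y z = ℚ.toℚᵘ-injective (begin
    ℚ.toℚᵘ (ℤ→ℚ (y ℤ.* z))                    ≈⟨ toℚᵘ-ℤ→ℚ (y ℤ.* z) ⟩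
    ℚᵘ.mkℚᵘ y 0 ℚᵘ.* ℚᵘ.mkℚᵘ z 0              ≈⟨ ℚᵘ.*-cong (toℚᵘ-ℤ→ℚ y) (toℚᵘ-ℤ→ℚ z) ⟨
    ℚ.toℚᵘ (ℤ→ℚ y) ℚᵘ.* ℚ.toℚᵘ (ℤ→ℚ z)        ≈⟨ ℚ.toℚᵘ-homo-* (ℤ→ℚ y) (ℤ→ℚ z) ⟨
    ℚ.toℚᵘ (ℤ→ℚ y ℚ.* ℤ→ℚ z)                  ∎)
    where open ℚᵘ.≃-Reasoning

  -‿homo : ∀ z → ℤ→ℚ (ℤ.- z) ≡ ℚ.- ℤ→ℚ z
  -‿homo (+ 0)       = ≡.refl
  -‿homo ℤ.+[1+ n ]  = ≡.refl
  -‿homo ℤ.-[1+ n ]  = ≡.sym (RingProperties.-‿involutive ℚ.+-*-ring (ℤ→ℚ ℤ.+[1+ n ]))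

  morphism : ℤ.+-*-rawRing -Raw-AlmostCommutative⟶ fromCommutativeRing ℚ.+-*-commutativeRing
  morphism = record
    { ⟦_⟧    = ℤ→ℚ
    ; +-homo = +-homo
    ; *-homo = *-homo
    ; -‿homo = -‿homo
    ; 0-homo = ≡.refl
    ; 1-homo = ≡.refl
    }

  coeff≟ : ∀ y z → Maybe (ℤ→ℚ y ≡ ℤ→ℚ z)
  coeff≟ y z with y ℤ.≟ z
  ... | yes y≡z = just (≡.cong ℤ→ℚ y≡z)
  ... | no _    = nothing

-- Integer coefficients, because arithmetic in ℚ normalises slowly.
module ℚ-Solver = RingSolver ℤ.+-*-rawRing (fromCommutativeRing ℚ.+-*-commutativeRing)
  ℤ→ℚ-Homomorphism.morphism ℤ→ℚ-Homomorphism.coeff≟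

record DedekindCut ℓ : Set (lsuc ℓ) where
  field
    L U         : Pred ℚ ℓ
    L-inhabited : ∃ L
    U-inhabited : ∃ U
    L-rounded   : ∀ s → L s ⇔ (∃[ t ] s ℚ.< t × L t)
    U-rounded   : ∀ t → U t ⇔ (∃[ s ] s ℚ.< t × U s)
    disjoint    : ∀ s → L s → ¬ U s
    located     : ∀ {s t} → s ℚ.< t → L s ⊎ U t

-- An Archimedean ordered field in which every Dedekind cut of ℚ is realised:
-- these axioms determine ℝ up to a unique isomorphism.  The strict order is
-- primitive, and x ≤ y stands for ¬ (y < x).  As ℚ is the prime field, the
-- embedding ι is uniquely determined and so is no extra structure.
record RealNumbers c ℓ₁ ℓ₂ : Set (lsuc (c ⊔ ℓ₁ ⊔ ℓ₂)) where
  infix 4 _<_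
  field
    heytingField : HeytingField c ℓ₁ ℓ₂

  open HeytingField heytingField public

  commutativeRing : CommutativeRing c ℓ₁
  commutativeRing = HeytingCommutativeRing.commutativeRing heytingCommutativeRing

  field
    _<_                  : Rel Carrier ℓ₂
    isStrictPartialOrder : IsStrictPartialOrder _≈_ _<_
    #⇔<⊎>                : ∀ {x y} → x # y ⇔ (x < y ⊎ y < x)
    +-monoʳ-<            : ∀ z {x y} → x < y → z + x < z + y
    *-pos                : ∀ {x y} → 0# < x → 0# < y → 0# < x * y
    ι                    : ℚ → Carrier
    ι-isRingHomomorphism :
      RingMorphisms.IsRingHomomorphism ℚ.+-*-rawRing (CommutativeRing.rawRing commutativeRing) ι
    ι-mono-<             : ∀ {s t} → s ℚ.< t → ι s < ι t
    archimedean          : ∀ {x y} → x < y → ∃[ s ] x < ι s × ι s < y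
    complete             : (C : DedekindCut ℓ₂) →
      ∃[ x ] ∀ s → (DedekindCut.L C s ⇔ ι s < x) × (DedekindCut.U C s ⇔ x < ι s)

module RealAnalysis {c ℓ₁ ℓ₂} (ℝ : RealNumbers c ℓ₁ ℓ₂) where
  open RealNumbers ℝ public
  open CommutativeRing commutativeRing public
    using (ring; semiring; commutativeSemiring; rawRing)
  open HeytingProperties heytingCommutativeRing public
  open RingMorphisms ℚ.+-*-rawRing rawRing using (module IsRingHomomorphism)
  open IsRingHomomorphism ι-isRingHomomorphism public
    using () renaming (+-homo to ι-+; *-homo to ι-*; -‿homo to ι-neg; 0#-homo to ι-0; 1#-homo to ι-1)
  module < = IsStrictPartialOrder isStrictPartialOrder
  open Exp commutativeSemiring public using (_^_; ^-congˡ; ^-distrib-*)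
  open Summation semiring public using (sum)

  infix 4 _≤_
  _≤_ : Rel Carrier ℓ₂
  x ≤ y = ¬ (y < x)

  private
    -- The embedding of ℤ, but sending 0 and 1 to 0# and 1# definitionally.
    ι′ : ℤ → Carrier
    ι′ (+ 0) = 0#
    ι′ (+ 1) = 1#
    ι′ z     = ι (ℤ→ℚ z)

    ι′≈ι : ∀ z → ι′ z ≈ ι (ℤ→ℚ z)
    ι′≈ι (+ 0)             = sym ι-0
    ι′≈ι (+ 1)             = sym ι-1
    ι′≈ι (+ suc (suc _))   = refl
    ι′≈ι ℤ.-[1+ _ ]        = refl

    open ℤ→ℚ-Homomorphism using (+-homo; *-homo; -‿homo)

    morphism : ℤ.+-*-rawRing -Raw-AlmostCommutative⟶ fromCommutativeRing commutativeRing
    morphism = record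
      { ⟦_⟧    = ι′
      ; +-homo = λ y z → trans (ι′≈ι (y ℤ.+ z)) (trans (reflexive (≡.cong ι (+-homo y z)))
                   (trans (ι-+ _ _) (sym (+-cong (ι′≈ι y) (ι′≈ι z)))))
      ; *-homo = λ y z → trans (ι′≈ι (y ℤ.* z)) (trans (reflexive (≡.cong ι (*-homo y z)))
                   (trans (ι-* _ _) (sym (*-cong (ι′≈ι y) (ι′≈ι z)))))
      ; -‿homo = λ z → trans (ι′≈ι (ℤ.- z)) (trans (reflexive (≡.cong ι (-‿homo z)))
                   (trans (ι-neg _) (sym (-‿cong (ι′≈ι z)))))
      ; 0-homo = refl
      ; 1-homo = refl
      }

    coeff≟ : ∀ y z → Maybe (ι′ y ≈ ι′ z)
    coeff≟ y z with y ℤ.≟ z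
    ... | yes ≡.refl = just refl
    ... | no _       = nothing

  open RingSolver ℤ.+-*-rawRing (fromCommutativeRing commutativeRing) morphism coeff≟ public
    using (solve; _:=_; _:+_; _:*_; _:-_; :-_; con)

  abstract
    <⇒# : ∀ {x y} → x < y → x # y
    <⇒# x<y = Equivalence.from #⇔<⊎> (inj₁ x<y)

    <-respʳ : ∀ {x y z} → y ≈ z → x < y → x < z
    <-respʳ = proj₁ <.<-resp-≈

    <-respˡ : ∀ {x y z} → y ≈ z → y < x → z < x
    <-respˡ = proj₂ <.<-resp-≈

    <-cotrans : ∀ {x y} → x < y → ∀ z → x < z ⊎ z < y
    <-cotrans x<y z with #-cotrans (<⇒# x<y) z
    ... | inj₁ x#z with Equivalence.to #⇔<⊎> x#z
    ...   | inj₁ x<z = inj₁ x<z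
    ...   | inj₂ z<x = inj₂ (<.trans z<x x<y)
    <-cotrans x<y z | inj₂ z#y with Equivalence.to #⇔<⊎> z#y
    ...   | inj₁ z<y = inj₂ z<y
    ...   | inj₂ y<z = inj₁ (<.trans x<y y<z)

    ≤-trans : ∀ {x y z} → x ≤ y → y ≤ z → x ≤ z
    ≤-trans {y = y} x≤y y≤z z<x = [ y≤z , x≤y ]′ (<-cotrans z<x y)

    ≤-antisym : ∀ {x y} → x ≤ y → y ≤ x → x ≈ y
    ≤-antisym x≤y y≤x = proj₁ (tight _ _) λ x#y → [ y≤x , x≤y ]′ (Equivalence.to #⇔<⊎> x#y)

    0<-diff : ∀ {x y} → x < y → 0# < y - x
    0<-diff {x} {y} x<y = <-respˡ (-‿inverseˡ x) (<-respʳ (+-comm (- x) y) (+-monoʳ-< (- x) x<y))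

    diff-0< : ∀ {x y} → 0# < y - x → x < y
    diff-0< {x} {y} 0<y-x = <-respˡ (+-identityʳ x)
      (<-respʳ (solve 2 (λ x y → x :+ (y :- x) := y) refl x y) (+-monoʳ-< x 0<y-x))

    +-mono-< : ∀ {x y z w} → x < y → z < w → x + z < y + w
    +-mono-< {x} {y} {z} {w} x<y z<w = <.trans (+-monoʳ-< x z<w)
      (<-respˡ (+-comm w x) (<-respʳ (+-comm w y) (+-monoʳ-< w x<y)))

    +-pos : ∀ {x y} → 0# < x → 0# < y → 0# < x + y
    +-pos 0<x 0<y = <-respˡ (+-identityˡ 0#) (+-mono-< 0<x 0<y)

    *-monoʳ-< : ∀ {z x y} → 0# < z → x < y → z * x < z * y
    *-monoʳ-< {z} {x} {y} 0<z x<y = diff-0<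
      (<-respʳ (solve 3 (λ z x y → z :* (y :- x) := z :* y :- z :* x) refl z x y) (*-pos 0<z (0<-diff x<y)))

    *-monoˡ-< : ∀ {z x y} → 0# < z → x < y → x * z < y * z
    *-monoˡ-< {z} {x} {y} 0<z x<y = <-respˡ (*-comm z x) (<-respʳ (*-comm z y) (*-monoʳ-< 0<z x<y))

    0<1 : 0# < 1#
    0<1 = <-respˡ ι-0 (<-respʳ ι-1 (ι-mono-< (ℚ.positive⁻¹ 1ℚ)))

    ι-pos : ∀ {s} → 0ℚ ℚ.< s → 0# < ι s
    ι-pos 0<s = <-respˡ ι-0 (ι-mono-< 0<s)

    ι-cancel-< : ∀ {s t} → ι s < ι t → s ℚ.< t
    ι-cancel-< {s} {t} ιs<ιt with ℚ.<-cmp s t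
    ... | tri< s<t _ _    = s<t
    ... | tri≈ _ ≡.refl _ = ⊥-elim (<.irrefl refl ιs<ιt)
    ... | tri> _ _ t<s    = ⊥-elim (<.asym ιs<ιt (ι-mono-< t<s))

  infix 8 _⁻¹[_]
  infixl 7 _÷_[_]

  abstract
    private
      inverse : ∀ {x} → 0# < x → ∃[ y ] x * y ≈ 1#
      inverse {x} 0<x with #⇒invertible (#-sym (<⇒# 0<x))
      ... | y , _ , x-0*y≈1 = y , trans (*-congʳ (sym (x-0≈x x))) x-0*y≈1

    _⁻¹[_] : ∀ x → 0# < x → Carrier
    x ⁻¹[ 0<x ] = proj₁ (inverse 0<x)

    ⁻¹-inverseʳ : ∀ {x} (0<x : 0# < x) → x * x ⁻¹[ 0<x ] ≈ 1#
    ⁻¹-inverseʳ 0<x = proj₂ (inverse 0<x)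

  _÷_[_] : Carrier → ∀ d → 0# < d → Carrier
  x ÷ d [ 0<d ] = x * d ⁻¹[ 0<d ]

  abstract
    *-cancelˡ-0< : ∀ {x y} → 0# < x → 0# < x * y → 0# < y
    *-cancelˡ-0< {x} {y} 0<x 0<xy =
      [ (λ y<0 → ⊥-elim (<.asym 0<xy (<-respʳ (zeroʳ x) (*-monoʳ-< 0<x y<0)))) , (λ 0<y → 0<y) ]′
        (Equivalence.to #⇔<⊎> y#0)
      where
      y#0 : y # 0#
      y#0 = invertibleʳ⇒# (x * (x * y) ⁻¹[ 0<xy ] , trans (*-congʳ (x-0≈x y))
        (trans (solve 3 (λ x y z → y :* (x :* z) := x :* y :* z) refl x y _) (⁻¹-inverseʳ 0<xy)))

    ⁻¹-pos : ∀ {x} (0<x : 0# < x) → 0# < x ⁻¹[ 0<x ]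
    ⁻¹-pos 0<x = *-cancelˡ-0< 0<x (<-respʳ (sym (⁻¹-inverseʳ 0<x)) 0<1)

    ÷-* : ∀ x {d} (0<d : 0# < d) → x ÷ d [ 0<d ] * d ≈ x
    ÷-* x {d} 0<d = trans (solve 3 (λ x d e → x :* e :* d := x :* (d :* e)) refl x d _)
      (trans (*-congˡ (⁻¹-inverseʳ 0<d)) (*-identityʳ x))

    ÷-pos : ∀ {x d} (0<d : 0# < d) → 0# < x → 0# < x ÷ d [ 0<d ]
    ÷-pos 0<d 0<x = *-pos 0<x (⁻¹-pos 0<d)

    *-cancelʳ-< : ∀ {x y z} → 0# < z → x * z < y * z → x < y
    *-cancelʳ-< {x} {y} {z} 0<z xz<yz = diff-0< (*-cancelˡ-0< 0<z
      (<-respʳ (solve 3 (λ x y z → y :* z :- x :* z := z :* (y :- x)) refl x y z) (0<-diff xz<yz)))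

    ^-pos : ∀ {x} → 0# < x → ∀ n → 0# < x ^ n
    ^-pos 0<x zero    = 0<1
    ^-pos 0<x (suc n) = *-pos 0<x (^-pos 0<x n)

    1^n≈1 : ∀ n → 1# ^ n ≈ 1#
    1^n≈1 zero    = refl
    1^n≈1 (suc n) = trans (*-identityˡ _) (1^n≈1 n)

    ^-mono-< : ∀ {x y} → 0# < x → x < y → ∀ n .{{_ : ℕ.NonZero n}} → x ^ n < y ^ n
    ^-mono-< 0<x x<y (suc zero)    = <-respˡ (sym (*-identityʳ _)) (<-respʳ (sym (*-identityʳ _)) x<y)
    ^-mono-< 0<x x<y (suc (suc n)) = <.trans (*-monoʳ-< 0<x (^-mono-< 0<x x<y (suc n)))
      (*-monoˡ-< (^-pos (<.trans 0<x x<y) (suc n)) x<y)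

    ^-cancel-< : ∀ {x y} → 0# < x → 0# < y → ∀ n → x ^ n < y ^ n → x < y
    ^-cancel-< 0<x 0<y zero    1<1 = ⊥-elim (<.irrefl refl 1<1)
    ^-cancel-< {x} {y} 0<x 0<y (suc n) xⁿ<yⁿ with <-cotrans xⁿ<yⁿ (y * x ^ n)
    ... | inj₁ p = *-cancelʳ-< (^-pos 0<x n) p
    ... | inj₂ p = ^-cancel-< 0<x 0<y n
            (*-cancelʳ-< 0<y (<-respˡ (*-comm y _) (<-respʳ (*-comm y _) p)))

  abstract
    private
      between : ∀ {x y z} → x < y → x < z → ∃[ w ] x < w × w < y × w < z
      between x<y x<z with archimedean x<y | archimedean x<z
      ... | s , x<s , s<y | t , x<t , t<z with ℚ.<-cmp s t
      ...   | tri< s<t _ _    = ι s , x<s , s<y , <.trans (ι-mono-< s<t) t<z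
      ...   | tri≈ _ ≡.refl _ = ι s , x<s , s<y , t<z
      ...   | tri> _ _ t<s    = ι t , x<t , <.trans (ι-mono-< t<s) s<y , t<z

      between′ : ∀ {x y z} → y < x → z < x → ∃[ w ] w < x × y < w × z < w
      between′ y<x z<x with archimedean y<x | archimedean z<x
      ... | s , y<s , s<x | t , z<t , t<x with ℚ.<-cmp s t
      ...   | tri< s<t _ _    = ι t , t<x , <.trans y<s (ι-mono-< s<t) , z<t
      ...   | tri≈ _ ≡.refl _ = ι s , s<x , y<s , z<t
      ...   | tri> _ _ t<s    = ι s , s<x , y<s , <.trans z<t (ι-mono-< t<s)

      *-pos-mono : ∀ {x y z w} → 0# < x → 0# < z → x < y → z < w → x * z < y * w
      *-pos-mono 0<x 0<z x<y z<w = <.trans (*-monoʳ-< 0<x z<w) (*-monoˡ-< (<.trans 0<z z<w) x<y)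

      raise : ∀ {x} → 0# < x → ∀ n {b} → x ^ n < b → ∃[ y ] x < y × y ^ n < b
      raise {x} 0<x zero 1<b =
        x + 1# , <-respˡ (+-identityʳ x) (+-monoʳ-< x 0<1) , 1<b
      raise {x} 0<x (suc n) {b} xxⁿ<b =
        let s , xxⁿ<s , s<b = archimedean xxⁿ<b
            0<xⁿ = ^-pos 0<x n
            x′ = ι s ÷ x ^ n [ 0<xⁿ ]
            x<x′ : x < x′
            x<x′ = *-cancelʳ-< 0<xⁿ (<-respʳ (sym (÷-* (ι s) 0<xⁿ)) xxⁿ<s)
            0<x′ = <.trans 0<x x<x′
            w = b ÷ x′ [ 0<x′ ]
            xⁿ<w : x ^ n < w
            xⁿ<w = *-cancelʳ-< 0<x′ (<-respˡ (trans (sym (÷-* (ι s) 0<xⁿ)) (*-comm x′ _))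
              (<-respʳ (sym (÷-* b 0<x′)) s<b))
            y , x<y , yⁿ<w = raise 0<x n xⁿ<w
            z , x<z , z<x′ , z<y = between x<x′ x<y
            0<z = <.trans 0<x x<z
        in z , x<z , <-respʳ (trans (*-comm x′ w) (÷-* b 0<x′))
             (zzⁿ<x′w 0<z z<x′ z<y n yⁿ<w)
        where
        zzⁿ<x′w : ∀ {z y x′ w} → 0# < z → z < x′ → z < y → ∀ n → y ^ n < w → z * z ^ n < x′ * w
        zzⁿ<x′w 0<z z<x′ z<y zero    yⁿ<w = *-pos-mono 0<z 0<1 z<x′ yⁿ<w
        zzⁿ<x′w 0<z z<x′ z<y (suc n) yⁿ<w =
          *-pos-mono 0<z (^-pos 0<z (suc n)) z<x′ (<.trans (^-mono-< 0<z z<y (suc n)) yⁿ<w)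

      lower : ∀ {x b} → 0# < x → 0# < b → ∀ n → b < x ^ n → ∃[ y ] 0# < y × y < x × b < y ^ n
      lower 0<x 0<b zero b<1 = let s , 0<s , s<x = archimedean 0<x in ι s , 0<s , s<x , b<1
      lower {x} {b} 0<x 0<b (suc n) b<xxⁿ =
        let s , b<s , s<xxⁿ = archimedean b<xxⁿ
            0<xⁿ = ^-pos 0<x n
            x′ = ι s ÷ x ^ n [ 0<xⁿ ]
            0<s = <.trans 0<b b<s
            x′<x : x′ < x
            x′<x = *-cancelʳ-< 0<xⁿ (<-respˡ (sym (÷-* (ι s) 0<xⁿ)) s<xxⁿ)
            0<x′ = ÷-pos 0<xⁿ 0<s
            w = b ÷ x′ [ 0<x′ ]
            0<w = ÷-pos 0<x′ 0<b
            w<xⁿ : w < x ^ n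
            w<xⁿ = *-cancelʳ-< 0<x′ (<-respʳ (trans (sym (÷-* (ι s) 0<xⁿ)) (*-comm x′ _))
              (<-respˡ (sym (÷-* b 0<x′)) b<s))
            y , 0<y , y<x , w<yⁿ = lower 0<x 0<w n w<xⁿ
            z , z<x , x′<z , y<z = between′ x′<x y<x
        in z , <.trans 0<y y<z , z<x , <-respˡ (trans (*-comm x′ w) (÷-* b 0<x′))
             (x′w<zzⁿ 0<x′ 0<w 0<y x′<z y<z n w<yⁿ)
        where
        x′w<zzⁿ : ∀ {z y x′ w} → 0# < x′ → 0# < w → 0# < y → x′ < z → y < z → ∀ n → w < y ^ n → x′ * w < z * z ^ n
        x′w<zzⁿ 0<x′ 0<w 0<y x′<z y<z zero    w<yⁿ = *-pos-mono 0<x′ 0<w x′<z w<yⁿ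
        x′w<zzⁿ 0<x′ 0<w 0<y x′<z y<z (suc n) w<yⁿ =
          *-pos-mono 0<x′ 0<w x′<z (<.trans w<yⁿ (^-mono-< 0<y y<z (suc n)))

      ^-raise-rational : ∀ {y a} → 0# < y → ∀ n .{{_ : ℕ.NonZero n}} → y ^ n < a → ∃[ s ] y < ι s × ι s ^ n < a
      ^-raise-rational 0<y n yⁿ<a with raise 0<y n yⁿ<a
      ... | z , y<z , zⁿ<a with archimedean y<z
      ...   | s , y<s , s<z = s , y<s , <.trans (^-mono-< (<.trans 0<y y<s) s<z n) zⁿ<a

      ^-lower-rational : ∀ {y a} → 0# < y → 0# < a → ∀ n .{{_ : ℕ.NonZero n}} → a < y ^ n →
        ∃[ s ] 0ℚ ℚ.< s × ι s < y × a < ι s ^ n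
      ^-lower-rational 0<y 0<a n a<yⁿ with lower 0<y 0<a n a<yⁿ
      ... | z , 0<z , z<y , a<zⁿ with archimedean z<y
      ...   | s , z<s , s<y =
        s , ι-cancel-< (<-respˡ (sym ι-0) (<.trans 0<z z<s)) , s<y , <.trans a<zⁿ (^-mono-< 0<z z<s n)

      rootCut : ∀ {a} → 0# < a → ∀ n .{{_ : ℕ.NonZero n}} → DedekindCut ℓ₂
      rootCut {a} 0<a n = record
        { L           = L
        ; U           = U
        ; L-inhabited = 0ℚ , inj₁ ℚ.≤-refl
        ; U-inhabited = inhabited
        ; L-rounded   = λ s → mk⇔ (L-open s) λ (t , s<t , Lt) → L-down s<t Lt
        ; U-rounded   = λ t → mk⇔ U-open λ (s , s<t , 0<s , a<sⁿ) →
                          ℚ.<-trans 0<s s<t , <.trans a<sⁿ (^-mono-< (ι-pos 0<s) (ι-mono-< s<t) n)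
        ; disjoint    = λ { s (inj₁ s≤0) (0<s , _) → ℚ.<-irrefl ≡.refl (ℚ.<-≤-trans 0<s s≤0)
                          ; s (inj₂ sⁿ<a) (_ , a<sⁿ) → <.asym sⁿ<a a<sⁿ }
        ; located     = λ {s} {t} → locate s t
        }
        where
        L U : Pred ℚ ℓ₂
        L s = s ℚ.≤ 0ℚ ⊎ ι s ^ n < a
        U s = 0ℚ ℚ.< s × a < ι s ^ n

        L-down : ∀ {s t} → s ℚ.< t → L t → L s
        L-down s<t (inj₁ t≤0) = inj₁ (ℚ.<⇒≤ (ℚ.<-≤-trans s<t t≤0))
        L-down {s} s<t (inj₂ tⁿ<a) with s ℚ.≤? 0ℚ
        ... | yes s≤0 = inj₁ s≤0
        ... | no  s≰0 = inj₂ (<.trans (^-mono-< (ι-pos (ℚ.≰⇒> s≰0)) (ι-mono-< s<t) n) tⁿ<a)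

        small : ∃[ s ] 0ℚ ℚ.< s × ι s ^ n < a
        small with between 0<a 0<1
        ... | w , 0<w , w<a , w<1 with archimedean 0<w
        ...   | s , 0<s , s<w = s , ι-cancel-< (<-respˡ (sym ι-0) 0<s) ,
                  shrink n (<.trans s<w w<1)
          where
          shrink : ∀ n .{{_ : ℕ.NonZero n}} → ι s < 1# → ι s ^ n < a
          shrink (suc zero)    s<1 = <-respˡ (sym (*-identityʳ _)) (<.trans s<w w<a)
          shrink (suc (suc n)) s<1 = <.trans (*-monoʳ-< 0<s (^-mono-< 0<s s<1 (suc n)))
            (<-respˡ (sym (trans (*-congˡ (1^n≈1 (suc n))) (*-identityʳ _))) (<.trans s<w w<a))

        L-open : ∀ s → L s → ∃[ t ] s ℚ.< t × L t
        L-open s Ls with s ℚ.≤? 0ℚ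
        ... | yes s≤0 = let t , 0<t , tⁿ<a = small in t , ℚ.≤-<-trans s≤0 0<t , inj₂ tⁿ<a
        L-open s (inj₁ s≤0)  | no s≰0 = ⊥-elim (s≰0 s≤0)
        L-open s (inj₂ sⁿ<a) | no s≰0 =
          let t , s<t , tⁿ<a = ^-raise-rational (ι-pos (ℚ.≰⇒> s≰0)) n sⁿ<a
          in t , ι-cancel-< s<t , inj₂ tⁿ<a

        U-open : ∀ {t} → U t → ∃[ s ] s ℚ.< t × U s
        U-open (0<t , a<tⁿ) =
          let s , 0<s , s<t , a<sⁿ = ^-lower-rational (ι-pos 0<t) 0<a n a<tⁿ
          in s , ι-cancel-< s<t , 0<s , a<sⁿ

        inhabited : ∃ U
        inhabited with archimedean (<-respˡ (+-identityʳ a) (+-monoʳ-< a 0<1))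
        ... | s , a<s , _ = t , 0<t , grow n
          where
          t : ℚ
          t = s ℚ.+ 1ℚ
          s<t : ι s < ι t
          s<t = <-respʳ (sym (trans (ι-+ s 1ℚ) (+-congˡ ι-1))) (<-respˡ (+-identityʳ _) (+-monoʳ-< (ι s) 0<1))
          0<t : 0ℚ ℚ.< t
          0<t = ι-cancel-< (<-respˡ (sym ι-0) (<.trans 0<a (<.trans a<s s<t)))
          1<t : 1# < ι t
          1<t = <-respʳ (sym (trans (ι-+ s 1ℚ) (trans (+-congˡ ι-1) (+-comm _ _))))
            (<-respˡ (+-identityʳ _) (+-monoʳ-< 1# (<.trans 0<a a<s)))
          grow : ∀ n .{{_ : ℕ.NonZero n}} → a < ι t ^ n
          grow (suc zero)    = <-respʳ (sym (*-identityʳ _)) (<.trans a<s s<t)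
          grow (suc (suc n)) = <.trans (<-respʳ (sym (trans (*-congˡ (1^n≈1 (suc n))) (*-identityʳ _))) (<.trans a<s s<t))
            (*-monoʳ-< (ι-pos 0<t) (^-mono-< 0<1 1<t (suc n)))

        locate : ∀ s t → s ℚ.< t → L s ⊎ U t
        locate s t s<t with s ℚ.≤? 0ℚ
        ... | yes s≤0 = inj₁ (inj₁ s≤0)
        ... | no  s≰0 with <-cotrans (^-mono-< (ι-pos (ℚ.≰⇒> s≰0)) (ι-mono-< s<t) n) a
        ...   | inj₁ sⁿ<a = inj₁ (inj₂ sⁿ<a)
        ...   | inj₂ a<tⁿ = inj₂ (ℚ.<-trans (ℚ.≰⇒> s≰0) s<t , a<tⁿ)

      realises-root : ∀ {a} (0<a : 0# < a) n .{{_ : ℕ.NonZero n}} → ∀ y →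
        (∀ s → (DedekindCut.L (rootCut 0<a n) s ⇔ ι s < y) × (DedekindCut.U (rootCut 0<a n) s ⇔ y < ι s)) →
        0# < y × y ^ n ≈ a
      realises-root {a} 0<a n y cut = 0<y , ≤-antisym yⁿ≤a a≤yⁿ
        where
        0<y : 0# < y
        0<y = <-respˡ ι-0 (Equivalence.to (proj₁ (cut 0ℚ)) (inj₁ ℚ.≤-refl))
        a≤yⁿ : a ≤ y ^ n
        a≤yⁿ yⁿ<a with ^-raise-rational 0<y n yⁿ<a
        ... | s , y<s , sⁿ<a = <.asym sⁿ<a (proj₂ (Equivalence.from (proj₂ (cut s)) y<s))
        yⁿ≤a : y ^ n ≤ a
        yⁿ≤a a<yⁿ with ^-lower-rational 0<y 0<a n a<yⁿ
        ... | s , 0<s , s<y , a<sⁿ with Equivalence.from (proj₁ (cut s)) s<y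
        ...   | inj₁ s≤0  = ℚ.<-irrefl ≡.refl (ℚ.<-≤-trans 0<s s≤0)
        ...   | inj₂ sⁿ<a = <.asym sⁿ<a a<sⁿ

      root : ∀ {a} → 0# < a → ∀ n .{{_ : ℕ.NonZero n}} → ∃[ y ] 0# < y × y ^ n ≈ a
      root 0<a n with complete (rootCut 0<a n)
      ... | y , cut = y , realises-root 0<a n y cut

    nthRoot : ∀ n .{{_ : ℕ.NonZero n}} a → 0# < a → Carrier
    nthRoot n a 0<a = proj₁ (root 0<a n)

    nthRoot-pos : ∀ n .{{_ : ℕ.NonZero n}} {a} (0<a : 0# < a) → 0# < nthRoot n a 0<a
    nthRoot-pos n 0<a = proj₁ (proj₂ (root 0<a n))

    nthRoot-^ : ∀ n .{{_ : ℕ.NonZero n}} {a} (0<a : 0# < a) → nthRoot n a 0<a ^ n ≈ a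
    nthRoot-^ n 0<a = proj₂ (proj₂ (root 0<a n))

  -- x^(p/q) for x > 0
  rpow : (p q : ℕ) .{{_ : ℕ.NonZero q}} (x : Carrier) → 0# < x → Carrier
  rpow p q x 0<x = nthRoot q (x ^ p) (^-pos 0<x p)

  LinearlyIndependent : ∀ {n} → Vector Carrier n → Set ℓ₁
  LinearlyIndependent {n} v = ∀ (s : Vector ℚ n) → sum (λ i → ι (s i) * v i) ≈ 0# → ∀ i → s i ≡ 0ℚ

  Point : Set c
  Point = Carrier × Carrier

  triangle : Vector Point 3 → Pred Point (c ⊔ ℓ₁ ⊔ ℓ₂)
  triangle V (x , y) = Σ[ w ∈ Vector Carrier 3 ] (∀ i → 0# ≤ w i) × sum w ≈ 1#
    × x ≈ sum (λ i → w i * proj₁ (V i)) × y ≈ sum (λ i → w i * proj₂ (V i))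

  interior : ∀ {ℓ} → Pred Point ℓ → Pred Point (c ⊔ ℓ₂ ⊔ ℓ)
  interior A (x , y) = ∃[ ρ ] 0# < ρ × (∀ u v → (u - x) ^ 2 + (v - y) ^ 2 < ρ ^ 2 → A (u , v))

-- A subfield of ℝ of dimension 3 over ℚ.  Inverses are required for x ≉ 0#
-- rather than x # 0#, because a number field has decidable equality: x ≈ 0#
-- holds exactly when all coordinates of x vanish.
record CubicField {c ℓ₁ ℓ₂} (ℝ : RealNumbers c ℓ₁ ℓ₂) k : Set (c ⊔ ℓ₁ ⊔ lsuc k) where
  open RealAnalysis ℝ
  field
    K             : Pred Carrier k
    K-resp        : ∀ {x y} → x ≈ y → x ∈ K → y ∈ K
    K-ι           : ∀ s → ι s ∈ K
    K-+           : ∀ {x y} → x ∈ K → y ∈ K → x + y ∈ K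
    K-neg         : ∀ {x} → x ∈ K → - x ∈ K
    K-*           : ∀ {x y} → x ∈ K → y ∈ K → x * y ∈ K
    K-inv         : ∀ {x} → x ∈ K → ¬ x ≈ 0# → ∃[ y ] y ∈ K × x * y ≈ 1#
    basis         : Vector Carrier 3
    basis∈K       : ∀ i → basis i ∈ K
    basis-indep   : LinearlyIndependent basis
    basis-span    : ∀ {x} → x ∈ K → Σ[ s ∈ Vector ℚ 3 ] x ≈ sum (λ i → ι (s i) * basis i)

private
  det′ : ∀ {A : Set} → (_+_ _-_ _*_ : A → A → A) → (Fin 3 → Fin 3 → A) → A
  det′ _+_ _-_ _*_ m =
    ((m 0F 0F * ((m 1F 1F * m 2F 2F) - (m 1F 2F * m 2F 1F)))
    - (m 0F 1F * ((m 1F 0F * m 2F 2F) - (m 1F 2F * m 2F 0F))))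
    + (m 0F 2F * ((m 1F 0F * m 2F 1F) - (m 1F 1F * m 2F 0F)))

det : (Fin 3 → Fin 3 → ℚ) → ℚ
det = det′ ℚ._+_ ℚ._-_ ℚ._*_

infix 8 _·ᵥ_
_·ᵥ_ : Vector ℚ 3 → (Fin 3 → Fin 3 → ℚ) → Vector ℚ 3
(a ·ᵥ m) j = a 0F ℚ.* m 0F j ℚ.+ a 1F ℚ.* m 1F j ℚ.+ a 2F ℚ.* m 2F j

abstract
  nonsingular : ∀ m → (∀ a → (∀ j → (a ·ᵥ m) j ≡ 0ℚ) → ∀ i → a i ≡ 0ℚ) → det m ≢ 0ℚ
  nonsingular m kernel det≡0 = 1≢0 (kernel (1ℚ ∷ 0ℚ ∷ 0ℚ ∷ []) (λ j →
      ≡.trans (solve 3 (λ a b c → con 1ℤ :* a :+ con 0ℤ :* b :+ con 0ℤ :* c := a) ≡.refl _ (m 1F j) (m 2F j))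
        (row₀≡0 j)) 0F)
    where
    open ℚ-Solver
    1≢0 : 1ℚ ≢ 0ℚ
    1≢0 ()
    -- Cyclic indices absorb the signs of the cofactors.
    cofactors : ∀ {A : Set} → (_-_ _*_ : A → A → A) → (Fin 3 → Fin 3 → A) → Fin 3 → Vector A 3
    cofactors _-_ _*_ m k =
        ((m 1F k₁ * m 2F k₂) - (m 1F k₂ * m 2F k₁))
      ∷ ((m 2F k₁ * m 0F k₂) - (m 2F k₂ * m 0F k₁))
      ∷ ((m 0F k₁ * m 1F k₂) - (m 0F k₂ * m 1F k₁)) ∷ []
      where
      next : Fin 3 → Fin 3
      next 0F = 1F
      next 1F = 2F
      next 2F = 0F
      k₁ k₂ : Fin 3
      k₁ = next k
      k₂ = next k₁
    C : Fin 3 → Vector ℚ 3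
    C = cofactors ℚ._-_ ℚ._*_ m
    entries : Vec ℚ 9
    entries = Vec.tabulate λ i → uncurry m (remQuot 3 i)
    μ : Fin 3 → Fin 3 → Polynomial 9
    μ i j = var (combine i j)
    Cμ : Fin 3 → Vector (Polynomial 9) 3
    Cμ = cofactors _:-_ _:*_ μ
    row : Fin 3 → Fin 3 → Polynomial 9
    row k j = Cμ k 0F :* μ 0F j :+ Cμ k 1F :* μ 1F j :+ Cμ k 2F :* μ 2F j
    detμ : Polynomial 9
    detμ = det′ _:+_ _:-_ _:*_ μ
    expand : ∀ k j → (C k ·ᵥ m) j ≡ 0ℚ
    expand 0F 0F = ≡.trans (prove entries (row 0F 0F) detμ ≡.refl) det≡0
    expand 0F 1F = prove entries (row 0F 1F) (con 0ℤ) ≡.refl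
    expand 0F 2F = prove entries (row 0F 2F) (con 0ℤ) ≡.refl
    expand 1F 0F = prove entries (row 1F 0F) (con 0ℤ) ≡.refl
    expand 1F 1F = ≡.trans (prove entries (row 1F 1F) detμ ≡.refl) det≡0
    expand 1F 2F = prove entries (row 1F 2F) (con 0ℤ) ≡.refl
    expand 2F 0F = prove entries (row 2F 0F) (con 0ℤ) ≡.refl
    expand 2F 1F = prove entries (row 2F 1F) (con 0ℤ) ≡.refl
    expand 2F 2F = ≡.trans (prove entries (row 2F 2F) detμ ≡.refl) det≡0
    C₂≡0 : ∀ k → C k 2F ≡ 0ℚ
    C₂≡0 k = kernel (C k) (expand k) 2F
    same : ∀ i j → m 0F j ℚ.* m 1F i ℚ.- m 0F i ℚ.* m 1F j ≡ 0ℚ → m 1F i ℚ.* m 0F j ℚ.- m 0F i ℚ.* m 1F j ≡ 0ℚ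
    same i j = ≡.trans (≡.cong (ℚ._- m 0F i ℚ.* m 1F j) (ℚ.*-comm (m 1F i) (m 0F j)))
    flip : ∀ i j → m 0F i ℚ.* m 1F j ℚ.- m 0F j ℚ.* m 1F i ≡ 0ℚ → m 1F i ℚ.* m 0F j ℚ.- m 0F i ℚ.* m 1F j ≡ 0ℚ
    flip i j eq = ≡.trans (solve 4 (λ a b c d → a :* b :- c :* d := :- (c :* d :- b :* a)) ≡.refl
      (m 1F i) (m 0F j) (m 0F i) (m 1F j)) (≡.cong ℚ.-_ eq)
    minor≡0 : ∀ i j → m 1F i ℚ.* m 0F j ℚ.- m 0F i ℚ.* m 1F j ≡ 0ℚ
    minor≡0 0F 0F = solve 2 (λ a b → b :* a :- a :* b := con 0ℤ) ≡.refl (m 0F 0F) (m 1F 0F)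
    minor≡0 0F 1F = flip 0F 1F (C₂≡0 2F)
    minor≡0 0F 2F = same 0F 2F (C₂≡0 1F)
    minor≡0 1F 0F = same 1F 0F (C₂≡0 2F)
    minor≡0 1F 1F = solve 2 (λ a b → b :* a :- a :* b := con 0ℤ) ≡.refl (m 0F 1F) (m 1F 1F)
    minor≡0 1F 2F = flip 1F 2F (C₂≡0 0F)
    minor≡0 2F 0F = flip 2F 0F (C₂≡0 1F)
    minor≡0 2F 1F = same 2F 1F (C₂≡0 0F)
    minor≡0 2F 2F = solve 2 (λ a b → b :* a :- a :* b := con 0ℤ) ≡.refl (m 0F 2F) (m 1F 2F)
    row₀≡0 : ∀ j → m 0F j ≡ 0ℚ
    row₀≡0 j = ≡.trans (solve 1 (λ a → a := :- (:- a)) ≡.refl (m 0F j))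
      (≡.cong ℚ.-_ (kernel (m 1F j ∷ ℚ.- m 0F j ∷ 0ℚ ∷ []) (λ k → ≡.trans
        (solve 5 (λ a b c d e → a :* b :+ :- c :* d :+ con 0ℤ :* e := a :* b :- c :* d)
          ≡.refl (m 1F j) (m 0F k) (m 0F j) (m 1F k) (m 2F k)) (minor≡0 j k)) 1F))

module NumberField {c ℓ₁ ℓ₂ k} (ℝ : RealNumbers c ℓ₁ ℓ₂) (𝕂 : CubicField ℝ k) where
  open RealAnalysis ℝ
  open CubicField 𝕂

  -- Row i holds the coordinates of x * basis i, so N is the determinant of
  -- multiplication by x on the ℚ-vector space K.
  mulMatrix : ∀ {x} → x ∈ K → Fin 3 → Fin 3 → ℚ
  mulMatrix x∈K i = proj₁ (basis-span (K-* x∈K (basis∈K i)))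

  N : ∀ {x} → x ∈ K → ℚ
  N x∈K = det (mulMatrix x∈K)

  abstract
    K-1# : 1# ∈ K
    K-1# = K-resp ι-1 (K-ι 1ℚ)

    K-- : ∀ {x y} → x ∈ K → y ∈ K → x - y ∈ K
    K-- x∈K y∈K = K-+ x∈K (K-neg y∈K)

    K-^ : ∀ {x} → x ∈ K → ∀ n → x ^ n ∈ K
    K-^ x∈K zero    = K-1#
    K-^ x∈K (suc n) = K-* x∈K (K-^ x∈K n)

    K-≈0? : ∀ {x} → x ∈ K → x ≈ 0# ⊎ ¬ x ≈ 0#
    K-≈0? {x} x∈K = decide (ℚ³≟0 s)
      where
      s : Vector ℚ 3
      s = proj₁ (basis-span x∈K)
      x≈ : x ≈ sum (λ i → ι (s i) * basis i)
      x≈ = proj₂ (basis-span x∈K)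
      ℚ³≟0 : ∀ (s : Vector ℚ 3) → (∀ i → s i ≡ 0ℚ) ⊎ ¬ (∀ i → s i ≡ 0ℚ)
      ℚ³≟0 s with s 0F ℚ.≟ 0ℚ | s 1F ℚ.≟ 0ℚ | s 2F ℚ.≟ 0ℚ
      ... | yes p | yes q | yes r = inj₁ λ { 0F → p ; 1F → q ; 2F → r }
      ... | no p  | _     | _     = inj₂ λ s≡0 → p (s≡0 0F)
      ... | _     | no p  | _     = inj₂ λ s≡0 → p (s≡0 1F)
      ... | _     | _     | no p  = inj₂ λ s≡0 → p (s≡0 2F)
      term≈0 : ∀ i → s i ≡ 0ℚ → ι (s i) * basis i ≈ 0#
      term≈0 i sᵢ≡0 = trans (*-congʳ (trans (reflexive (≡.cong ι sᵢ≡0)) ι-0)) (zeroˡ _)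
      decide : (∀ i → s i ≡ 0ℚ) ⊎ ¬ (∀ i → s i ≡ 0ℚ) → x ≈ 0# ⊎ ¬ x ≈ 0#
      decide (inj₁ s≡0) = inj₁ (trans x≈ (trans (+-cong (term≈0 0F (s≡0 0F))
        (+-cong (term≈0 1F (s≡0 1F)) (+-congʳ (term≈0 2F (s≡0 2F)))))
        (trans (+-identityˡ _) (trans (+-identityˡ _) (+-identityˡ _)))))
      decide (inj₂ s≢0) = inj₂ λ x≈0 → s≢0 (basis-indep s (trans (sym x≈) x≈0))

    K-# : ∀ {x} → x ∈ K → ¬ x ≈ 0# → x # 0#
    K-# x∈K x≉0 = let y , _ , xy≈1 = K-inv x∈K x≉0
      in invertibleʳ⇒# (y , trans (*-congʳ (x-0≈x _)) xy≈1)

    K-cmp : ∀ {x y} → x ∈ K → y ∈ K → x < y ⊎ x ≈ y ⊎ y < x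
    K-cmp {x} {y} x∈K y∈K = [ inj₂ ∘ inj₁ ∘ close , apart ]′ (K-≈0? (K-- y∈K x∈K))
      where
      close : y - x ≈ 0# → x ≈ y
      close y-x≈0 = sym (trans (solve 2 (λ x y → y := x :+ (y :- x)) refl x y)
        (trans (+-congˡ y-x≈0) (+-identityʳ x)))
      apart : ¬ (y - x ≈ 0#) → x < y ⊎ x ≈ y ⊎ y < x
      apart y-x≉0 = [ inj₂ ∘ inj₂ ∘ (λ y-x<0 → <-respˡ (sym y≈) (<-respʳ (+-identityʳ x) (+-monoʳ-< x y-x<0)))
                    , inj₁ ∘ diff-0< ]′ (Equivalence.to #⇔<⊎> (K-# (K-- y∈K x∈K) y-x≉0))
        where
        y≈ : y ≈ x + (y - x)
        y≈ = solve 2 (λ x y → y := x :+ (y :- x)) refl x y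

    N≢0 : ∀ {x} (x∈K : x ∈ K) → ¬ x ≈ 0# → N x∈K ≢ 0ℚ
    N≢0 {x} x∈K x≉0 = nonsingular m kernel
      where
      y : Carrier
      y = proj₁ (K-inv x∈K x≉0)
      xy≈1 : x * y ≈ 1#
      xy≈1 = proj₂ (proj₂ (K-inv x∈K x≉0))
      m : Fin 3 → Fin 3 → ℚ
      m = mulMatrix x∈K
      comb : Vector ℚ 3 → Carrier
      comb s = sum (λ i → ι (s i) * basis i)
      ι-·ᵥ : ∀ a j → ι ((a ·ᵥ m) j) ≈ ι (a 0F) * ι (m 0F j) + ι (a 1F) * ι (m 1F j) + ι (a 2F) * ι (m 2F j)
      ι-·ᵥ a j = trans (ι-+ _ _) (+-cong (trans (ι-+ _ _) (+-cong (ι-* _ _) (ι-* _ _))) (ι-* _ _))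
      x*basis : ∀ i → x * basis i ≈ comb (m i)
      x*basis i = proj₂ (basis-span (K-* x∈K (basis∈K i)))
      x*comb : ∀ a → x * comb a ≈ comb (a ·ᵥ m)
      x*comb a = trans
        (solve 7 (λ x a₀ a₁ a₂ b₀ b₁ b₂ →
          x :* (a₀ :* b₀ :+ (a₁ :* b₁ :+ (a₂ :* b₂ :+ con 0ℤ)))
          := a₀ :* (x :* b₀) :+ (a₁ :* (x :* b₁) :+ a₂ :* (x :* b₂)))
          refl x (ι (a 0F)) (ι (a 1F)) (ι (a 2F)) (basis 0F) (basis 1F) (basis 2F))
        (trans (+-cong (*-congˡ (x*basis 0F)) (+-cong (*-congˡ (x*basis 1F)) (*-congˡ (x*basis 2F))))
        (trans
          (solve 15 (λ a₀ a₁ a₂ b₀ b₁ b₂ m₀₀ m₀₁ m₀₂ m₁₀ m₁₁ m₁₂ m₂₀ m₂₁ m₂₂ →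
            a₀ :* (m₀₀ :* b₀ :+ (m₀₁ :* b₁ :+ (m₀₂ :* b₂ :+ con 0ℤ)))
            :+ (a₁ :* (m₁₀ :* b₀ :+ (m₁₁ :* b₁ :+ (m₁₂ :* b₂ :+ con 0ℤ)))
            :+ a₂ :* (m₂₀ :* b₀ :+ (m₂₁ :* b₁ :+ (m₂₂ :* b₂ :+ con 0ℤ))))
            := (a₀ :* m₀₀ :+ a₁ :* m₁₀ :+ a₂ :* m₂₀) :* b₀
            :+ ((a₀ :* m₀₁ :+ a₁ :* m₁₁ :+ a₂ :* m₂₁) :* b₁
            :+ ((a₀ :* m₀₂ :+ a₁ :* m₁₂ :+ a₂ :* m₂₂) :* b₂ :+ con 0ℤ)))
            refl (ι (a 0F)) (ι (a 1F)) (ι (a 2F)) (basis 0F) (basis 1F) (basis 2F)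
            (ι (m 0F 0F)) (ι (m 0F 1F)) (ι (m 0F 2F)) (ι (m 1F 0F)) (ι (m 1F 1F)) (ι (m 1F 2F))
            (ι (m 2F 0F)) (ι (m 2F 1F)) (ι (m 2F 2F)))
          (sym (+-cong (*-congʳ (ι-·ᵥ a 0F)) (+-cong (*-congʳ (ι-·ᵥ a 1F)) (+-congʳ (*-congʳ (ι-·ᵥ a 2F))))))))
      kernel : ∀ a → (∀ j → (a ·ᵥ m) j ≡ 0ℚ) → ∀ i → a i ≡ 0ℚ
      kernel a am≡0 = basis-indep a (trans (sym (trans (*-congʳ xy≈1) (*-identityˡ _)))
        (trans (solve 3 (λ x y z → x :* y :* z := y :* (x :* z)) refl x y (comb a))
        (trans (*-congˡ (trans (x*comb a) comb≈0)) (zeroʳ y))))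
        where
        term≈0 : ∀ i → ι ((a ·ᵥ m) i) * basis i ≈ 0#
        term≈0 i = trans (*-congʳ (trans (reflexive (≡.cong ι (am≡0 i))) ι-0)) (zeroˡ _)
        comb≈0 : comb (a ·ᵥ m) ≈ 0#
        comb≈0 = trans (+-cong (term≈0 0F) (+-cong (term≈0 1F) (+-congʳ (term≈0 2F))))
          (trans (+-identityˡ _) (trans (+-identityˡ _) (+-identityˡ _)))

    K-⁻¹ : ∀ {x} → x ∈ K → (0<x : 0# < x) → x ⁻¹[ 0<x ] ∈ K
    K-⁻¹ {x} x∈K 0<x = K-resp y≈x⁻¹ (proj₁ (proj₂ y))
      where
      y : ∃[ y ] y ∈ K × x * y ≈ 1#
      y = K-inv x∈K (λ x≈0 → <.irrefl (sym x≈0) 0<x)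
      y≈x⁻¹ : proj₁ y ≈ x ⁻¹[ 0<x ]
      y≈x⁻¹ = trans (sym (*-identityʳ _)) (trans (*-congˡ (sym (⁻¹-inverseʳ 0<x)))
        (trans (solve 3 (λ x y z → y :* (x :* z) := x :* y :* z) refl x (proj₁ y) _)
        (trans (*-congʳ (proj₂ (proj₂ y))) (*-identityˡ _))))

    0<∣NN∣ : ∀ {x y} (x∈K : x ∈ K) (y∈K : y ∈ K) → 0# < x → 0# < y → 0# < ι ∣ N x∈K ℚ.* N y∈K ∣
    0<∣NN∣ {x} {y} x∈K y∈K 0<x 0<y = ι-pos (ℚ.≰⇒> λ ∣NN∣≤0 →
      [ N≢0 x∈K (x≉0 0<x) , N≢0 y∈K (x≉0 0<y) ]′
        (ℚ*≡0 (N x∈K) (N y∈K) (ℚ.∣p∣≡0⇒p≡0 _ (ℚ.≤-antisym ∣NN∣≤0 (ℚ.0≤∣p∣ _)))))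
      where
      x≉0 : ∀ {x} → 0# < x → ¬ x ≈ 0#
      x≉0 0<x x≈0 = <.irrefl (sym x≈0) 0<x
      ℚ*≡0 : ∀ s t → s ℚ.* t ≡ 0ℚ → s ≡ 0ℚ ⊎ t ≡ 0ℚ
      ℚ*≡0 s t st≡0 with s ℚ.≟ 0ℚ
      ... | yes s≡0 = inj₁ s≡0
      ... | no  s≢0 = inj₂ (≡.trans (≡.sym (ℚ.*-identityˡ t)) (≡.trans (≡.cong (ℚ._* t) (≡.sym (ℚ.*-inverseˡ s)))
              (≡.trans (ℚ.*-assoc (ℚ.1/ s) s t) (≡.trans (≡.cong (ℚ.1/ s ℚ.*_) st≡0) (ℚ.*-zeroʳ (ℚ.1/ s))))))
        where
        instance
          s≠0 : ℚ.NonZero s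
          s≠0 = ℚ.≢-nonZero s≢0

  record ΔK : Set (c ⊔ ℓ₁ ⊔ ℓ₂ ⊔ k) where
    field
      α β         : Carrier
      α∈K         : α ∈ K
      β∈K         : β ∈ K
      independent : LinearlyIndependent (1# ∷ α ∷ β ∷ [])
      0<α         : 0# < α
      0<β         : 0# < β
      α+β<1       : α + β < 1#

    point : Point
    point = α , β

    γ : Carrier
    γ = 1# - α - β

    abstract
      γ∈K : γ ∈ K
      γ∈K = K-- (K-- K-1# α∈K) β∈K

      0<γ : 0# < γ
      0<γ = <-respʳ (solve 2 (λ x y → con 1ℤ :- (x :+ y) := con 1ℤ :- x :- y) refl α β) (0<-diff α+β<1)

  independent₃ : (x : ΔK) → ∀ s t u → let open ΔK x in
    ι s + ι t * α + ι u * β ≈ 0# → s ≡ 0ℚ × t ≡ 0ℚ × u ≡ 0ℚ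
  independent₃ x s t u eq = indep 0F , indep 1F , indep 2F
    where
    open ΔK x
    indep : ∀ i → (s ∷ t ∷ u ∷ []) i ≡ 0ℚ
    indep = independent (s ∷ t ∷ u ∷ []) (trans
      (solve 5 (λ s t u a b → s :* con 1ℤ :+ (t :* a :+ (u :* b :+ con 0ℤ)) := s :+ t :* a :+ u :* b)
        refl (ι s) (ι t) (ι u) α β) eq)

  Δ : Pred Point ℓ₂
  Δ (x , y) = 0# ≤ x × 0# ≤ y × x + y ≤ 1#

  data Ind : Set where
    ⟨1,2⟩ ⟨2,1⟩ ⟨0,1⟩ ⟨1,0⟩ ⟨0,2⟩ ⟨2,0⟩ : Ind

  data UnorderedPair : Set where
    ｛1,2｝ ｛0,1｝ ｛0,2｝ : UnorderedPair

  unordered : Ind → UnorderedPair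
  unordered ⟨1,2⟩ = ｛1,2｝
  unordered ⟨2,1⟩ = ｛1,2｝
  unordered ⟨0,1⟩ = ｛0,1｝
  unordered ⟨1,0⟩ = ｛0,1｝
  unordered ⟨0,2⟩ = ｛0,2｝
  unordered ⟨2,0⟩ = ｛0,2｝

  △ : Ind → Pred Point ℓ₂
  △ ⟨1,2⟩ (x , y) = (x , y) ∈ Δ × y ≤ x
  △ ⟨2,1⟩ (x , y) = (x , y) ∈ Δ × x ≤ y
  △ ⟨0,1⟩ (x , y) = (x , y) ∈ Δ × x + x + y - 1# ≤ 0#
  △ ⟨1,0⟩ (x , y) = (x , y) ∈ Δ × 0# ≤ x + x + y - 1#
  △ ⟨0,2⟩ (x , y) = (x , y) ∈ Δ × x + (y + y) - 1# ≤ 0#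
  △ ⟨2,0⟩ (x , y) = (x , y) ∈ Δ × 0# ≤ x + (y + y) - 1#

  -- The coordinates of T⟨ e ⟩ (x , y) are the quotients of numerator₁ e x y and
  -- numerator₂ e x y by denominator e x y.
  numerator₁ numerator₂ denominator : Ind → Carrier → Carrier → Carrier
  numerator₁ ⟨1,2⟩ x y = x - y
  numerator₁ ⟨2,1⟩ x y = x
  numerator₁ ⟨0,1⟩ x y = x
  numerator₁ ⟨1,0⟩ x y = x + x + y - 1#
  numerator₁ ⟨0,2⟩ x y = x
  numerator₁ ⟨2,0⟩ x y = x

  numerator₂ ⟨1,2⟩ x y = y
  numerator₂ ⟨2,1⟩ x y = y - x
  numerator₂ ⟨0,1⟩ x y = y
  numerator₂ ⟨1,0⟩ x y = y
  numerator₂ ⟨0,2⟩ x y = y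
  numerator₂ ⟨2,0⟩ x y = x + (y + y) - 1#

  denominator ⟨1,2⟩ x y = 1# - y
  denominator ⟨2,1⟩ x y = 1# - x
  denominator ⟨0,1⟩ x y = 1# - x
  denominator ⟨1,0⟩ x y = x + y
  denominator ⟨0,2⟩ x y = 1# - y
  denominator ⟨2,0⟩ x y = x + y

  abstract
    0<denominator : ∀ e (x : ΔK) → 0# < denominator e (ΔK.α x) (ΔK.β x)
    0<denominator e x = go e
      where
      open ΔK x
      0<1-β : 0# < 1# - β
      0<1-β = <-respʳ (solve 2 (λ x y → x :+ (con 1ℤ :- x :- y) := con 1ℤ :- y) refl α β) (+-pos 0<α 0<γ)
      0<1-α : 0# < 1# - α
      0<1-α = <-respʳ (solve 2 (λ x y → y :+ (con 1ℤ :- x :- y) := con 1ℤ :- x) refl α β) (+-pos 0<β 0<γ)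
      go : ∀ e → 0# < denominator e α β
      go ⟨1,2⟩ = 0<1-β
      go ⟨2,1⟩ = 0<1-α
      go ⟨0,1⟩ = 0<1-α
      go ⟨1,0⟩ = +-pos 0<α 0<β
      go ⟨0,2⟩ = 0<1-β
      go ⟨2,0⟩ = +-pos 0<α 0<β

    α≉β : (x : ΔK) → ¬ ΔK.α x ≈ ΔK.β x
    α≉β x α≈β = case proj₁ (proj₂ (independent₃ x 0ℚ 1ℚ (ℚ.- 1ℚ) (trans
        (+-cong (+-cong ι-0 (*-congʳ ι-1)) (*-congʳ (trans (ι-neg 1ℚ) (-‿cong ι-1))))
        (trans (solve 2 (λ x y → con 0ℤ :+ con 1ℤ :* x :+ (:- con 1ℤ) :* y := x :- y) refl α β)
        (trans (+-congʳ α≈β) (-‿inverseʳ β)))))) of λ ()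
      where open ΔK x

    2α+β≉1 : (x : ΔK) → ¬ ΔK.α x + ΔK.α x + ΔK.β x - 1# ≈ 0#
    2α+β≉1 x eq = case proj₂ (proj₂ (independent₃ x (ℚ.- 1ℚ) (1ℚ ℚ.+ 1ℚ) 1ℚ (trans
        (+-cong (+-cong (trans (ι-neg 1ℚ) (-‿cong ι-1)) (*-congʳ (trans (ι-+ 1ℚ 1ℚ) (+-cong ι-1 ι-1)))) (*-congʳ ι-1))
        (trans (solve 2 (λ x y → :- con 1ℤ :+ (con 1ℤ :+ con 1ℤ) :* x :+ con 1ℤ :* y := x :+ x :+ y :- con 1ℤ) refl α β)
        eq)))) of λ ()
      where open ΔK x

    α+2β≉1 : (x : ΔK) → ¬ ΔK.α x + (ΔK.β x + ΔK.β x) - 1# ≈ 0#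
    α+2β≉1 x eq = case proj₁ (proj₂ (independent₃ x (ℚ.- 1ℚ) 1ℚ (1ℚ ℚ.+ 1ℚ) (trans
        (+-cong (+-cong (trans (ι-neg 1ℚ) (-‿cong ι-1)) (*-congʳ ι-1)) (*-congʳ (trans (ι-+ 1ℚ 1ℚ) (+-cong ι-1 ι-1))))
        (trans (solve 2 (λ x y → :- con 1ℤ :+ con 1ℤ :* x :+ (con 1ℤ :+ con 1ℤ) :* y := x :+ (y :+ y) :- con 1ℤ) refl α β)
        eq)))) of λ ()
      where open ΔK x

    K-≤⇒< : ∀ {x y} → x ∈ K → y ∈ K → ¬ x ≈ y → x ≤ y → x < y
    K-≤⇒< x∈K y∈K x≉y x≤y = [ (λ x<y → x<y) , [ ⊥-elim ∘ x≉y , ⊥-elim ∘ x≤y ]′ ]′ (K-cmp x∈K y∈K)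

    K-≤-total : ∀ {x y} → x ∈ K → y ∈ K → x ≤ y ⊎ y ≤ x
    K-≤-total x∈K y∈K = [ inj₁ ∘ <.asym , [ (λ x≈y → inj₁ (<.irrefl (sym x≈y))) , inj₂ ∘ <.asym ]′ ]′ (K-cmp x∈K y∈K)

    K-0# : 0# ∈ K
    K-0# = K-resp ι-0 (K-ι 0ℚ)

    K-2α+β-1 : (x : ΔK) → ΔK.α x + ΔK.α x + ΔK.β x - 1# ∈ K
    K-2α+β-1 x = K-- (K-+ (K-+ α∈K α∈K) β∈K) K-1#
      where open ΔK x

    K-α+2β-1 : (x : ΔK) → ΔK.α x + (ΔK.β x + ΔK.β x) - 1# ∈ K
    K-α+2β-1 x = K-- (K-+ α∈K (K-+ β∈K β∈K)) K-1#
      where open ΔK x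

    numerators-pos : ∀ e (x : ΔK) → ΔK.point x ∈ △ e → let open ΔK x in
      0# < numerator₁ e α β × 0# < numerator₂ e α β × numerator₁ e α β + numerator₂ e α β < denominator e α β
    numerators-pos ⟨1,2⟩ x (_ , β≤α) = 0<-diff (K-≤⇒< β∈K α∈K (α≉β x ∘ sym) β≤α) , 0<β ,
        diff-0< (<-respʳ (solve 2 (λ x y → con 1ℤ :- x :- y := con 1ℤ :- y :- (x :- y :+ y)) refl α β) 0<γ)
      where open ΔK x
    numerators-pos ⟨2,1⟩ x (_ , α≤β) = 0<α , 0<-diff (K-≤⇒< α∈K β∈K (α≉β x) α≤β) ,
        diff-0< (<-respʳ (solve 2 (λ x y → con 1ℤ :- x :- y := con 1ℤ :- x :- (x :+ (y :- x))) refl α β) 0<γ)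
      where open ΔK x
    numerators-pos ⟨0,1⟩ x (_ , h≤0) = 0<α , 0<β ,
        diff-0< (<-respʳ (solve 2 (λ x y → con 0ℤ :- (x :+ x :+ y :- con 1ℤ) := con 1ℤ :- x :- (x :+ y)) refl α β)
          (0<-diff (K-≤⇒< (K-2α+β-1 x) K-0# (2α+β≉1 x) h≤0)))
      where open ΔK x
    numerators-pos ⟨1,0⟩ x (_ , 0≤h) = K-≤⇒< K-0# (K-2α+β-1 x) (2α+β≉1 x ∘ sym) 0≤h , 0<β ,
        diff-0< (<-respʳ (solve 2 (λ x y → con 1ℤ :- x :- y := x :+ y :- (x :+ x :+ y :- con 1ℤ :+ y)) refl α β) 0<γ)
      where open ΔK x
    numerators-pos ⟨0,2⟩ x (_ , h≤0) = 0<α , 0<β ,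
        diff-0< (<-respʳ (solve 2 (λ x y → con 0ℤ :- (x :+ (y :+ y) :- con 1ℤ) := con 1ℤ :- y :- (x :+ y)) refl α β)
          (0<-diff (K-≤⇒< (K-α+2β-1 x) K-0# (α+2β≉1 x) h≤0)))
      where open ΔK x
    numerators-pos ⟨2,0⟩ x (_ , 0≤h) = 0<α , K-≤⇒< K-0# (K-α+2β-1 x) (α+2β≉1 x ∘ sym) 0≤h ,
        diff-0< (<-respʳ (solve 2 (λ x y → con 1ℤ :- x :- y := x :+ y :- (x :+ (x :+ (y :+ y) :- con 1ℤ))) refl α β) 0<γ)
      where open ΔK x

    K-numerator₁ : ∀ e (x : ΔK) → numerator₁ e (ΔK.α x) (ΔK.β x) ∈ K
    K-numerator₁ ⟨1,2⟩ x = K-- (ΔK.α∈K x) (ΔK.β∈K x)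
    K-numerator₁ ⟨2,1⟩ x = ΔK.α∈K x
    K-numerator₁ ⟨0,1⟩ x = ΔK.α∈K x
    K-numerator₁ ⟨1,0⟩ x = K-2α+β-1 x
    K-numerator₁ ⟨0,2⟩ x = ΔK.α∈K x
    K-numerator₁ ⟨2,0⟩ x = ΔK.α∈K x

    K-numerator₂ : ∀ e (x : ΔK) → numerator₂ e (ΔK.α x) (ΔK.β x) ∈ K
    K-numerator₂ ⟨1,2⟩ x = ΔK.β∈K x
    K-numerator₂ ⟨2,1⟩ x = K-- (ΔK.β∈K x) (ΔK.α∈K x)
    K-numerator₂ ⟨0,1⟩ x = ΔK.β∈K x
    K-numerator₂ ⟨1,0⟩ x = ΔK.β∈K x
    K-numerator₂ ⟨0,2⟩ x = ΔK.β∈K x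
    K-numerator₂ ⟨2,0⟩ x = K-α+2β-1 x

    K-denominator : ∀ e (x : ΔK) → denominator e (ΔK.α x) (ΔK.β x) ∈ K
    K-denominator ⟨1,2⟩ x = K-- K-1# (ΔK.β∈K x)
    K-denominator ⟨2,1⟩ x = K-- K-1# (ΔK.α∈K x)
    K-denominator ⟨0,1⟩ x = K-- K-1# (ΔK.α∈K x)
    K-denominator ⟨1,0⟩ x = K-+ (ΔK.α∈K x) (ΔK.β∈K x)
    K-denominator ⟨0,2⟩ x = K-- K-1# (ΔK.β∈K x)
    K-denominator ⟨2,0⟩ x = K-+ (ΔK.α∈K x) (ΔK.β∈K x)

    forms-independent : ∀ e (x : ΔK) → let open ΔK x in ∀ s t u →
      ι s * denominator e α β + ι t * numerator₁ e α β + ι u * numerator₂ e α β ≈ 0# →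
      s ≡ 0ℚ × t ≡ 0ℚ × u ≡ 0ℚ
    forms-independent e x s t u = go e
      where
      open ΔK x
      ι-- : ∀ s t → ι (s ℚ.- t) ≈ ι s - ι t
      ι-- s t = trans (ι-+ s (ℚ.- t)) (+-congˡ (ι-neg t))
      ι-+₃ : ∀ s t u → ι (s ℚ.+ t ℚ.+ u) ≈ ι s + ι t + ι u
      ι-+₃ s t u = trans (ι-+ _ u) (+-congʳ (ι-+ s t))
      form : ∀ a b c {a′ b′ c′ z} → ι a ≈ a′ → ι b ≈ b′ → ι c ≈ c′ → a′ + b′ * α + c′ * β ≈ z → z ≈ 0# →
             a ≡ 0ℚ × b ≡ 0ℚ × c ≡ 0ℚ
      form a b c a≈ b≈ c≈ eq z≈0 = independent₃ x a b c
        (trans (+-cong (+-cong a≈ (*-congʳ b≈)) (*-congʳ c≈)) (trans eq z≈0))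
      x+0≡0 : ∀ x → x ℚ.+ 0ℚ ≡ 0ℚ → x ≡ 0ℚ
      x+0≡0 x = ≡.trans (≡.sym (ℚ.+-identityʳ x))
      0+x≡0 : ∀ x → 0ℚ ℚ.+ x ≡ 0ℚ → x ≡ 0ℚ
      0+x≡0 x = ≡.trans (≡.sym (ℚ.+-identityˡ x))
      -x≡0 : ∀ x → ℚ.- x ≡ 0ℚ → x ≡ 0ℚ
      -x≡0 x eq = ≡.trans (≡.sym (RingProperties.-‿involutive ℚ.+-*-ring x)) (≡.cong ℚ.-_ eq)
      -- Coefficients of 1, α, β in s * denominator + t * numerator₁ + u * numerator₂.
      coefficients : Ind → ℚ → ℚ → ℚ → ℚ × ℚ × ℚ
      coefficients ⟨1,2⟩ s t u = s , t , u ℚ.- s ℚ.- t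
      coefficients ⟨2,1⟩ s t u = s , t ℚ.- s ℚ.- u , u
      coefficients ⟨0,1⟩ s t u = s , t ℚ.- s , u
      coefficients ⟨1,0⟩ s t u = ℚ.- t , s ℚ.+ t ℚ.+ t , s ℚ.+ t ℚ.+ u
      coefficients ⟨0,2⟩ s t u = s , t , u ℚ.- s
      coefficients ⟨2,0⟩ s t u = ℚ.- u , s ℚ.+ t ℚ.+ u , s ℚ.+ u ℚ.+ u
      back : ∀ e s t u → let a , b , c = coefficients e s t u in
             a ≡ 0ℚ × b ≡ 0ℚ × c ≡ 0ℚ → s ≡ 0ℚ × t ≡ 0ℚ × u ≡ 0ℚ
      back ⟨1,2⟩ s t u (≡.refl , ≡.refl , eq) = ≡.refl , ≡.refl , x+0≡0 u (x+0≡0 _ eq)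
      back ⟨2,1⟩ s t u (≡.refl , eq , ≡.refl) = ≡.refl , x+0≡0 t (x+0≡0 _ eq) , ≡.refl
      back ⟨0,1⟩ s t u (≡.refl , eq , ≡.refl) = ≡.refl , x+0≡0 t eq , ≡.refl
      back ⟨1,0⟩ s t u (-t≡0 , eq , eq′) with -x≡0 t -t≡0
      ... | ≡.refl with x+0≡0 s (x+0≡0 _ eq)
      ...   | ≡.refl = ≡.refl , ≡.refl , 0+x≡0 u eq′
      back ⟨0,2⟩ s t u (≡.refl , ≡.refl , eq) = ≡.refl , ≡.refl , x+0≡0 u eq
      back ⟨2,0⟩ s t u (-u≡0 , eq , eq′) with -x≡0 u -u≡0
      ... | ≡.refl with x+0≡0 s (x+0≡0 _ eq′)
      ...   | ≡.refl = ≡.refl , 0+x≡0 t (x+0≡0 _ eq) , ≡.refl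
      go : ∀ e → ι s * denominator e α β + ι t * numerator₁ e α β + ι u * numerator₂ e α β ≈ 0# →
           s ≡ 0ℚ × t ≡ 0ℚ × u ≡ 0ℚ
      go ⟨1,2⟩ eq = back ⟨1,2⟩ s t u (form s t (u ℚ.- s ℚ.- t) refl refl (trans (ι-- (u ℚ.- s) t) (+-congʳ (ι-- u s)))
          (solve 5 (λ s t u x y → s :+ t :* x :+ (u :- s :- t) :* y := s :* (con 1ℤ :- y) :+ t :* (x :- y) :+ u :* y)
            refl (ι s) (ι t) (ι u) α β) eq)
      go ⟨2,1⟩ eq = back ⟨2,1⟩ s t u (form s (t ℚ.- s ℚ.- u) u refl (trans (ι-- (t ℚ.- s) u) (+-congʳ (ι-- t s))) refl
          (solve 5 (λ s t u x y → s :+ (t :- s :- u) :* x :+ u :* y := s :* (con 1ℤ :- x) :+ t :* x :+ u :* (y :- x))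
            refl (ι s) (ι t) (ι u) α β) eq)
      go ⟨0,1⟩ eq = back ⟨0,1⟩ s t u (form s (t ℚ.- s) u refl (ι-- t s) refl
          (solve 5 (λ s t u x y → s :+ (t :- s) :* x :+ u :* y := s :* (con 1ℤ :- x) :+ t :* x :+ u :* y)
            refl (ι s) (ι t) (ι u) α β) eq)
      go ⟨1,0⟩ eq = back ⟨1,0⟩ s t u (form (ℚ.- t) (s ℚ.+ t ℚ.+ t) (s ℚ.+ t ℚ.+ u) (ι-neg t) (ι-+₃ s t t) (ι-+₃ s t u)
          (solve 5 (λ s t u x y → :- t :+ (s :+ t :+ t) :* x :+ (s :+ t :+ u) :* y := s :* (x :+ y) :+ t :* (x :+ x :+ y :- con 1ℤ) :+ u :* y)
            refl (ι s) (ι t) (ι u) α β) eq)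
      go ⟨0,2⟩ eq = back ⟨0,2⟩ s t u (form s t (u ℚ.- s) refl refl (ι-- u s)
          (solve 5 (λ s t u x y → s :+ t :* x :+ (u :- s) :* y := s :* (con 1ℤ :- y) :+ t :* x :+ u :* y)
            refl (ι s) (ι t) (ι u) α β) eq)
      go ⟨2,0⟩ eq = back ⟨2,0⟩ s t u (form (ℚ.- u) (s ℚ.+ t ℚ.+ u) (s ℚ.+ u ℚ.+ u) (ι-neg u) (ι-+₃ s t u) (ι-+₃ s u u)
          (solve 5 (λ s t u x y → :- u :+ (s :+ t :+ u) :* x :+ (s :+ u :+ u) :* y := s :* (x :+ y) :+ t :* x :+ u :* (x :+ (y :+ y) :- con 1ℤ))
            refl (ι s) (ι t) (ι u) α β) eq)

  T⟨_⟩ : ∀ e (x : ΔK) → ΔK.point x ∈ △ e → ΔK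
  T⟨ e ⟩ x x∈△ = record
    { α           = α′
    ; β           = β′
    ; α∈K         = K-* (K-numerator₁ e x) (K-⁻¹ (K-denominator e x) 0<d)
    ; β∈K         = K-* (K-numerator₂ e x) (K-⁻¹ (K-denominator e x) 0<d)
    ; independent = independent′
    ; 0<α         = ÷-pos 0<d (proj₁ (numerators-pos e x x∈△))
    ; 0<β         = ÷-pos 0<d (proj₁ (proj₂ (numerators-pos e x x∈△)))
    ; α+β<1       = sum<1
    }
    where
    open ΔK x
    d = denominator e α β
    0<d = 0<denominator e x
    α′ = numerator₁ e α β ÷ d [ 0<d ]
    β′ = numerator₂ e α β ÷ d [ 0<d ]
    abstract
      sum<1 : α′ + β′ < 1#
      sum<1 = *-cancelʳ-< 0<d (<-respˡ (sym (trans (distribʳ d α′ β′) (+-cong (÷-* _ 0<d) (÷-* _ 0<d))))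
        (<-respʳ (sym (*-identityˡ d)) (proj₂ (proj₂ (numerators-pos e x x∈△)))))

      independent′ : LinearlyIndependent (1# ∷ α′ ∷ β′ ∷ [])
      independent′ s eq = λ { 0F → proj₁ zeros ; 1F → proj₁ (proj₂ zeros) ; 2F → proj₂ (proj₂ zeros) }
        where
        zeros : s 0F ≡ 0ℚ × s 1F ≡ 0ℚ × s 2F ≡ 0ℚ
        zeros = forms-independent e x (s 0F) (s 1F) (s 2F) (trans
          (+-cong (+-congˡ (*-congˡ (sym (÷-* _ 0<d)))) (*-congˡ (sym (÷-* _ 0<d))))
          (trans (solve 6 (λ s t u a b d → s :* d :+ t :* (a :* d) :+ u :* (b :* d)
                   := d :* (s :* con 1ℤ :+ (t :* a :+ (u :* b :+ con 0ℤ))))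
                   refl (ι (s 0F)) (ι (s 1F)) (ι (s 2F)) α′ β′ d)
          (trans (*-congˡ eq) (zeroʳ d))))

  Matrix : Set
  Matrix = Vector (Vector ℤ 3) 3

  infixr 7 _⊗_
  _⊗_ : Matrix → Matrix → Matrix
  (B ⊗ C) i j = ℤ-sum (λ l → B i l ℤ.* C l j)

  A : Ind → Matrix
  A ⟨1,2⟩ = (1ℤ ∷ 0ℤ ∷ 1ℤ ∷ [])
          ∷ (0ℤ ∷ 1ℤ ∷ 1ℤ ∷ [])
          ∷ (0ℤ ∷ 0ℤ ∷ 1ℤ ∷ []) ∷ []
  A ⟨2,1⟩ = (1ℤ ∷ 1ℤ ∷ 0ℤ ∷ [])
          ∷ (0ℤ ∷ 1ℤ ∷ 0ℤ ∷ [])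
          ∷ (0ℤ ∷ 1ℤ ∷ 1ℤ ∷ []) ∷ []
  A ⟨0,1⟩ = (1ℤ ∷ 1ℤ ∷ 0ℤ ∷ [])
          ∷ (0ℤ ∷ 1ℤ ∷ 0ℤ ∷ [])
          ∷ (0ℤ ∷ 0ℤ ∷ 1ℤ ∷ []) ∷ []
  A ⟨1,0⟩ = (+ 2 ∷ -1ℤ ∷ -1ℤ ∷ [])
          ∷ (1ℤ ∷ 0ℤ ∷ -1ℤ ∷ [])
          ∷ (0ℤ ∷ 0ℤ ∷ 1ℤ ∷ []) ∷ []
  A ⟨0,2⟩ = (1ℤ ∷ 0ℤ ∷ 1ℤ ∷ [])
          ∷ (0ℤ ∷ 1ℤ ∷ 0ℤ ∷ [])
          ∷ (0ℤ ∷ 0ℤ ∷ 1ℤ ∷ []) ∷ []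
  A ⟨2,0⟩ = (+ 2 ∷ -1ℤ ∷ -1ℤ ∷ [])
          ∷ (0ℤ ∷ 1ℤ ∷ 0ℤ ∷ [])
          ∷ (1ℤ ∷ -1ℤ ∷ 0ℤ ∷ []) ∷ []

  S : Matrix
  S = (1ℤ ∷ 1ℤ ∷ 1ℤ ∷ [])
    ∷ (0ℤ ∷ 1ℤ ∷ 0ℤ ∷ [])
    ∷ (0ℤ ∷ 0ℤ ∷ 1ℤ ∷ []) ∷ []

module Algorithm {c ℓ₁ ℓ₂ k} (ℝ : RealNumbers c ℓ₁ ℓ₂) (𝕂 : CubicField ℝ k)
                 (p q : ℕ) .{{_ : ℕ.NonZero q}} where
  open RealAnalysis ℝ
  open CubicField 𝕂
  open NumberField ℝ 𝕂

  weight : ∀ {x y} → x ∈ K → 0# < x → y ∈ K → 0# < y → Carrier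
  weight {x} {y} x∈K 0<x y∈K 0<y =
    rpow p q x 0<x * rpow p q y 0<y ÷ ι ∣ N x∈K ℚ.* N y∈K ∣ [ 0<∣NN∣ x∈K y∈K 0<x 0<y ]

  v : UnorderedPair → ΔK → Carrier
  v ｛1,2｝ x = weight α∈K 0<α β∈K 0<β where open ΔK x
  v ｛0,1｝ x = weight α∈K 0<α γ∈K 0<γ where open ΔK x
  v ｛0,2｝ x = weight β∈K 0<β γ∈K 0<γ where open ΔK x

  abstract
    weight-pos : ∀ {x y} (x∈K : x ∈ K) (0<x : 0# < x) (y∈K : y ∈ K) (0<y : 0# < y) →
                 0# < weight x∈K 0<x y∈K 0<y
    weight-pos x∈K 0<x y∈K 0<y =
      ÷-pos (0<∣NN∣ x∈K y∈K 0<x 0<y) (*-pos (nthRoot-pos q _) (nthRoot-pos q _))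

    weight-^ : ∀ {x y} (x∈K : x ∈ K) (0<x : 0# < x) (y∈K : y ∈ K) (0<y : 0# < y) →
               weight x∈K 0<x y∈K 0<y ^ q ∈ K
    weight-^ {x} {y} x∈K 0<x y∈K 0<y = K-resp
      (sym (trans (^-distrib-* _ _ q) (*-congʳ (trans (^-distrib-* _ _ q) (*-cong (nthRoot-^ q _) (nthRoot-^ q _))))))
      (K-* (K-* (K-^ x∈K p) (K-^ y∈K p)) (K-^ (K-⁻¹ (K-ι _) (0<∣NN∣ x∈K y∈K 0<x 0<y)) q))

    v-pos : ∀ a x → 0# < v a x
    v-pos ｛1,2｝ x = weight-pos α∈K 0<α β∈K 0<β where open ΔK x
    v-pos ｛0,1｝ x = weight-pos α∈K 0<α γ∈K 0<γ where open ΔK x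
    v-pos ｛0,2｝ x = weight-pos β∈K 0<β γ∈K 0<γ where open ΔK x

    v-^ : ∀ a x → v a x ^ q ∈ K
    v-^ ｛1,2｝ x = weight-^ α∈K 0<α β∈K 0<β where open ΔK x
    v-^ ｛0,1｝ x = weight-^ α∈K 0<α γ∈K 0<γ where open ΔK x
    v-^ ｛0,2｝ x = weight-^ β∈K 0<β γ∈K 0<γ where open ΔK x

    v-≤-total : ∀ x a b → v a x ≤ v b x ⊎ v b x ≤ v a x
    v-≤-total x a b = Sum.map (cancel a b) (cancel b a) (K-≤-total (v-^ a x) (v-^ b x))
      where
      cancel : ∀ a b → v a x ^ q ≤ v b x ^ q → v a x ≤ v b x
      cancel a b aᵠ≤bᵠ b<a = aᵠ≤bᵠ (^-mono-< (v-pos b x) b<a q)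

  -- If 3 ∤ p, the maximum is attained at one pair only and no choice is made.
  maximiser : ∀ x → Σ[ a ∈ UnorderedPair ] (∀ b → v b x ≤ v a x)
  maximiser x =
    [ (λ a≤b → [ (λ b≤c → ｛0,2｝ , λ { ｛1,2｝ → ≤-trans a≤b b≤c ; ｛0,1｝ → b≤c ; ｛0,2｝ → <.irrefl refl })
               , (λ c≤b → ｛0,1｝ , λ { ｛1,2｝ → a≤b ; ｛0,1｝ → <.irrefl refl ; ｛0,2｝ → c≤b }) ]′
               (v-≤-total x ｛0,1｝ ｛0,2｝))
    , (λ b≤a → [ (λ a≤c → ｛0,2｝ , λ { ｛1,2｝ → a≤c ; ｛0,1｝ → ≤-trans b≤a a≤c ; ｛0,2｝ → <.irrefl refl })
               , (λ c≤a → ｛1,2｝ , λ { ｛1,2｝ → <.irrefl refl ; ｛0,1｝ → b≤a ; ｛0,2｝ → c≤a }) ]′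
               (v-≤-total x ｛1,2｝ ｛0,2｝))
    ]′ (v-≤-total x ｛1,2｝ ｛0,1｝)

  orient : ∀ a (x : ΔK) → Σ[ e ∈ Ind ] unordered e ≡ a × ΔK.point x ∈ △ e
  orient a x = go a
    where
    open ΔK x
    inΔ : point ∈ Δ
    inΔ = <.asym 0<α , <.asym 0<β , <.asym α+β<1
    go : ∀ a → Σ[ e ∈ Ind ] unordered e ≡ a × point ∈ △ e
    go ｛1,2｝ = [ (λ β≤α → ⟨1,2⟩ , ≡.refl , inΔ , β≤α) , (λ α≤β → ⟨2,1⟩ , ≡.refl , inΔ , α≤β) ]′
      (K-≤-total β∈K α∈K)
    go ｛0,1｝ = [ (λ h≤0 → ⟨0,1⟩ , ≡.refl , inΔ , h≤0) , (λ 0≤h → ⟨1,0⟩ , ≡.refl , inΔ , 0≤h) ]′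
      (K-≤-total (K-2α+β-1 x) K-0#)
    go ｛0,2｝ = [ (λ h≤0 → ⟨0,2⟩ , ≡.refl , inΔ , h≤0) , (λ 0≤h → ⟨2,0⟩ , ≡.refl , inΔ , 0≤h) ]′
      (K-≤-total (K-α+2β-1 x) K-0#)

  ε-spec : ∀ x → Σ[ e ∈ Ind ] (∀ b → v b x ≤ v (unordered e) x) × ΔK.point x ∈ △ e
  ε-spec x =
    let a , a-max = maximiser x
        e , e≡a , x∈△ = orient a x
    in e , ≡.subst (λ a → ∀ b → v b x ≤ v a x) (≡.sym e≡a) a-max , x∈△

  ε : ΔK → Ind
  ε x = proj₁ (ε-spec x)

  T : ΔK → ΔK
  T x = T⟨ ε x ⟩ x (proj₂ (proj₂ (ε-spec x)))

  M : ΔK → ℕ → Matrix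
  M x n = foldr _⊗_ S (applyUpTo (λ i → A (ε (iterate T x i))) n)

  -- Column j of M x n gives the vertex j, and the columns 0F, 1F, 2F are those
  -- with entries p″, p′, p.  The existential says that none of these is 0.
  δ : ℕ → ΔK → Pred Point (c ⊔ ℓ₁ ⊔ ℓ₂)
  δ n x P = Σ[ nz ∈ (∀ j → ℚ.NonZero (ℤ→ℚ (M x n 0F j))) ]
    P ∈ interior (triangle λ j → let instance _ = nz j in
      ι (ℤ→ℚ (M x n 1F j) ℚ.÷ ℤ→ℚ (M x n 0F j)) , ι (ℤ→ℚ (M x n 2F j) ℚ.÷ ℤ→ℚ (M x n 0F j)))

{-# OPTIONS --safe #-}

-- In barycentric coordinates (1 - x - y , x , y) the map T⟨ i , j ⟩ subtracts the
-- coordinate j from the coordinate i and rescales by a positive factor.  Hence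
-- M x n = S P, where P is a product of the transvections undoing these
-- subtractions: P has natural entries and P ≥ I, so the first row of M x n is
-- positive, and P⁻¹ sends the barycentric coordinates of the point to a positive
-- multiple of those of its n-th iterate, which are positive.  The weights of (u , v)
-- with respect to the vertices are the coordinates of P⁻¹ (1 - u - v , u , v) times
-- the denominators of the vertices.  They are affine in (u , v) and positive at the
-- point, so they stay nonnegative on a disc around it.
module Submission where

open import Defs
open import Data.Nat.Base as ℕ using (ℕ; zero; suc; NonZero)
open import Data.Nat.Coprimality using (Coprime)
open import Data.Nat.Divisibility using (_∣_)
open import Relation.Nullary.Negation.Core using (¬_)
open import Relation.Unary using (_∈_)

open import Algebra.Bundles using (Semiring)
import Algebra.Properties.Semiring.Sum as Summation
open import Data.Empty using (⊥-elim)
open import Data.Fin.Base using (Fin; zero; suc)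
open import Data.Fin.Patterns using (0F; 1F; 2F)
open import Data.Fin.Properties using (all?)
open import Data.Integer.Base as ℤ using (ℤ; 0ℤ; 1ℤ; -1ℤ; +_)
import Data.Integer.Properties as ℤ
open import Data.Product.Base using (∃-syntax; _×_; _,_; proj₁; proj₂)
open import Data.Rational.Base as ℚ using (ℚ)
import Data.Rational.Properties as ℚ
open import Data.Sum.Base using ([_,_]′)
open import Data.Vec.Functional using (Vector; []; _∷_)
open import Relation.Binary.PropositionalEquality as ≡ using (_≡_)
import Relation.Binary.Reasoning.Setoid as SetoidReasoning
open import Relation.Nullary.Decidable using (Dec; toWitness)

module _ {c ℓ} (R : Semiring c ℓ) where
  open Semiring R
  open Summation R

  -- Stated over any semiring because it is used twice: over ℤ for associativity of `_⊗_`, and over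
  -- the reals for the compatibility of `_⊗_` with the action `_∙_`.
  sum-*-assoc : ∀ {m n} (a : Vector Carrier m) (B : Fin m → Fin n → Carrier) (c : Vector Carrier n) →
    sum (λ l → sum (λ k → a k * B k l) * c l) ≈ sum (λ k → a k * sum (λ l → B k l * c l))
  sum-*-assoc {m} {n} a B c = begin
    sum (λ l → sum (λ k → a k * B k l) * c l)    ≈⟨ sum-cong-≋ (λ l → *-distribʳ-sum (c l) (λ k → a k * B k l)) ⟩
    sum (λ l → sum (λ k → a k * B k l * c l))    ≈⟨ ∑-comm (λ l k → a k * B k l * c l) ⟩
    sum (λ k → sum (λ l → a k * B k l * c l))    ≈⟨ sum-cong-≋ (λ k → sum-cong-≋ (λ l → *-assoc (a k) (B k l) (c l))) ⟩
    sum (λ k → sum (λ l → a k * (B k l * c l)))  ≈⟨ sum-cong-≋ (λ k → *-distribˡ-sum (a k) (λ l → B k l * c l)) ⟨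
    sum (λ k → a k * sum (λ l → B k l * c l))    ∎
    where open SetoidReasoning setoid

-- Inequalities without a decidable order

module OrderedField {c ℓ₁ ℓ₂} (ℝ : RealNumbers c ℓ₁ ℓ₂) where
  open RealAnalysis ℝ

  -- Cotransitivity replaces a case split on signs: from `x + y < 0#`, either `x + y < x`, which
  -- makes `y` negative, or `x < 0#`.
  +-nonNeg : ∀ {x y} → 0# ≤ x → 0# ≤ y → 0# ≤ x + y
  +-nonNeg {x} {y} 0≤x 0≤y x+y<0 =
    [ (λ x+y<x → 0≤y (diff-0< (<-respʳ (solve 2 (λ x y → x :- (x :+ y) := con 0ℤ :- y) refl x y) (0<-diff x+y<x))))
    , 0≤x ]′ (<-cotrans x+y<0 x)

  *-nonNeg : ∀ {x y} → 0# < x → 0# ≤ y → 0# ≤ x * y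
  *-nonNeg {x} {y} 0<x 0≤y xy<0 = 0≤y (*-cancelʳ-< 0<x (<-respˡ (*-comm x y) (<-respʳ (sym (zeroˡ x)) xy<0)))

  -- A negative square excludes both signs of `x`, so `x ≈ 0#` by antisymmetry, and then the square
  -- vanishes.
  square-nonNeg : ∀ x → 0# ≤ x ^ 2
  square-nonNeg x x²<0 = <.irrefl x²≈0 x²<0
    where
    x≤0 : x ≤ 0#
    x≤0 0<x = <.asym x²<0 (^-pos 0<x 2)
    0≤x : 0# ≤ x
    0≤x x<0 = <.asym x²<0 (<-respʳ (solve 1 (λ x → (con 0ℤ :- x) :* ((con 0ℤ :- x) :* con 1ℤ) := x :* (x :* con 1ℤ)) refl x)
      (^-pos (0<-diff x<0) 2))
    x²≈0 : x ^ 2 ≈ 0#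
    x²≈0 = trans (*-congʳ (≤-antisym x≤0 0≤x)) (zeroˡ _)

  sum-nonNeg : ∀ {n} (a : Vector Carrier n) → (∀ i → 0# ≤ a i) → 0# ≤ sum a
  sum-nonNeg {zero}  a 0≤a = <.irrefl refl
  sum-nonNeg {suc n} a 0≤a = +-nonNeg (0≤a 0F) (sum-nonNeg (λ i → a (suc i)) (λ i → 0≤a (suc i)))

  -- The smaller of two reals cannot be selected by cases. Half the harmonic mean, `a r / (a + r)`,
  -- lies strictly below both instead.
  positive-lowerBound : ∀ {n} (a : Vector Carrier n) → (∀ i → 0# < a i) → ∃[ r ] 0# < r × (∀ i → r < a i)
  positive-lowerBound {zero}  a 0<a = 1# , 0<1 , λ ()
  positive-lowerBound {suc n} a 0<a =
    let r , 0<r , r<a = positive-lowerBound (λ i → a (suc i)) (λ i → 0<a (suc i))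
        0<b = +-pos (0<a 0F) 0<r
        s = a 0F * r ÷ a 0F + r [ 0<b ]
        s*b≈ = ÷-* (a 0F * r) 0<b
        s<a₀ = *-cancelʳ-< 0<b (<-respˡ (sym s*b≈) (*-monoʳ-< (0<a 0F) (r<x+r (0<a 0F))))
        s<r = *-cancelʳ-< 0<b (<-respˡ (trans (*-comm r (a 0F)) (sym s*b≈)) (*-monoʳ-< 0<r (x<x+r 0<r)))
    in s , ÷-pos 0<b (*-pos (0<a 0F) 0<r) , λ { 0F → s<a₀ ; (suc i) → <.trans s<r (r<a i) }
    where
    x<x+r : ∀ {x r} → 0# < r → x < x + r
    x<x+r {x} 0<r = <-respˡ (+-identityʳ x) (+-monoʳ-< x 0<r)
    r<x+r : ∀ {x r} → 0# < x → r < x + r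
    r<x+r {x} {r} 0<x = <-respʳ (+-comm r x) (x<x+r 0<x)

  nonNeg-+-pos : ∀ {x y} → 0# ≤ x → 0# < y → 0# < x + y
  nonNeg-+-pos {x} {y} 0≤x 0<y =
    [ (λ 0<x+y → 0<x+y)
    , (λ x+y<y → ⊥-elim (0≤x (diff-0< (<-respʳ (solve 2 (λ x y → y :- (x :+ y) := con 0ℤ :- x) refl x y) (0<-diff x+y<y)))))
    ]′ (<-cotrans 0<y (x + y))

  -- By Cauchy–Schwarz the radius ρ = h / (f² + g² + 1) works.
  affine-nonNeg-near : ∀ f g {h} → 0# < h → ∃[ ρ ] 0# < ρ ×
    (∀ a b → a ^ 2 + b ^ 2 < ρ ^ 2 → 0# ≤ h + (f * a + g * b))
  affine-nonNeg-near f g {h} 0<h = ρ , ÷-pos 0<k 0<h , nonNeg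
    where
    m = f ^ 2 + g ^ 2
    k = m + 1#
    0<k : 0# < k
    0<k = nonNeg-+-pos (+-nonNeg (square-nonNeg f) (square-nonNeg g)) 0<1
    ρ = h ÷ k [ 0<k ]
    nonNeg : ∀ a b → a ^ 2 + b ^ 2 < ρ ^ 2 → 0# ≤ h + (f * a + g * b)
    -- If the form were negative, then `h < t`, so `t ^ 2 - (ρ * k) ^ 2` and
    -- `k * (ρ ^ 2 - (a ^ 2 + b ^ 2))` would both be positive; but their sum is minus a sum of
    -- squares.
    nonNeg a b s<ρ² h-t<0 = sum-nonNeg (λ i → roots i ^ 2) (λ i → square-nonNeg (roots i))
      (diff-0< (<-respʳ identity (+-pos (0<-diff h²<t²) (*-pos 0<k (0<-diff s<ρ²)))))
      where
      t = - (f * a + g * b)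
      h<t : h < t
      h<t = diff-0< (<-respʳ (solve 2 (λ h l → con 0ℤ :- (h :+ l) := :- l :- h) refl h (f * a + g * b)) (0<-diff h-t<0))
      h²<t² : (ρ * k) ^ 2 < t ^ 2
      h²<t² = <-respˡ (^-congˡ 2 (sym (÷-* h 0<k))) (^-mono-< 0<h h<t 2)
      roots : Vector Carrier 6
      -- Lagrange's identity yields the first root, and `k = m + 1#` leaves `a` and `b` over. The
      -- last three come from `k * ρ ^ 2 - (ρ * k) ^ 2 = - (m + m ^ 2) * ρ ^ 2`.
      roots = f * b - g * a ∷ a ∷ b ∷ f * ρ ∷ g * ρ ∷ m * ρ ∷ []
      identity : t ^ 2 - (ρ * k) ^ 2 + k * (ρ ^ 2 - (a ^ 2 + b ^ 2)) ≈ 0# - sum (λ i → roots i ^ 2)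
      identity = solve 5 (λ f g a b ρ →
        let sq = λ x → x :* (x :* con 1ℤ)
            m = sq f :+ sq g
            k = m :+ con 1ℤ
        in sq (:- (f :* a :+ g :* b)) :- sq (ρ :* k) :+ k :* (sq ρ :- (sq a :+ sq b))
           := con 0ℤ :- (sq (f :* b :- g :* a) :+ (sq a :+ (sq b :+ (sq (f :* ρ) :+ (sq (g :* ρ) :+ (sq (m :* ρ) :+ con 0ℤ)))))))
        refl f g a b ρ

module Barycentric {c ℓ₁ ℓ₂ k} (ℝ : RealNumbers c ℓ₁ ℓ₂) (𝕂 : CubicField ℝ k) where
  open RealAnalysis ℝ
  open OrderedField ℝ
  open NumberField ℝ 𝕂
  open Summation ℤ.+-*-semiring using () renaming (sum to ℤ-sum; sum-cong-≗ to ℤ-sum-cong)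
  open Summation semiring using (sum-cong-≋)
  module ≈-Reasoning = SetoidReasoning setoid

  -- Integer matrices up to pointwise equality

  infix 4 _≐_ _≤ᴹ_
  _≐_ _≤ᴹ_ : Matrix → Matrix → Set
  B ≐ C = ∀ i j → B i j ≡ C i j
  B ≤ᴹ C = ∀ i j → B i j ℤ.≤ C i j

  -- Makes identities between explicit matrices provable by evaluation, through `toWitness`.
  _≐?_ : ∀ B C → Dec (B ≐ C)
  B ≐? C = all? λ i → all? λ j → B i j ℤ.≟ C i j

  _≤ᴹ?_ : ∀ B C → Dec (B ≤ᴹ C)
  B ≤ᴹ? C = all? λ i → all? λ j → B i j ℤ.≤? C i j

  O I : Matrix
  O i j = 0ℤ
  I = (1ℤ ∷ 0ℤ ∷ 0ℤ ∷ [])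
    ∷ (0ℤ ∷ 1ℤ ∷ 0ℤ ∷ [])
    ∷ (0ℤ ∷ 0ℤ ∷ 1ℤ ∷ []) ∷ []

  ⊗-assoc : ∀ B C D → (B ⊗ C) ⊗ D ≐ B ⊗ (C ⊗ D)
  ⊗-assoc B C D i j = sum-*-assoc ℤ.+-*-semiring (B i) C (λ l → D l j)

  ⊗-congˡ : ∀ B {C D} → C ≐ D → B ⊗ C ≐ B ⊗ D
  ⊗-congˡ B C≐D i j = ℤ-sum-cong (λ l → ≡.cong (B i l ℤ.*_) (C≐D l j))

  ⊗-congʳ : ∀ {B C} D → B ≐ C → B ⊗ D ≐ C ⊗ D
  ⊗-congʳ D B≐C i j = ℤ-sum-cong (λ l → ≡.cong (ℤ._* D l j) (B≐C i l))

  ⊗-mono-≤ : ∀ {B B′ C C′} → O ≤ᴹ B → B ≤ᴹ B′ → O ≤ᴹ C → C ≤ᴹ C′ → B ⊗ C ≤ᴹ B′ ⊗ C′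
  ⊗-mono-≤ {B} {B′} {C} {C′} O≤B B≤B′ O≤C C≤C′ i j =
    ℤ.+-mono-≤ (term 0F) (ℤ.+-mono-≤ (term 1F) (ℤ.+-mono-≤ (term 2F) ℤ.≤-refl))
    where
    term : ∀ l → B i l ℤ.* C l j ℤ.≤ B′ i l ℤ.* C′ l j
    term l = ℤ.≤-trans
      (ℤ.*-monoʳ-≤-nonNeg (C l j) {{ℤ.nonNegative (O≤C l j)}} (B≤B′ i l))
      (ℤ.*-monoˡ-≤-nonNeg (B′ i l) {{ℤ.nonNegative (ℤ.≤-trans (O≤B i l) (B≤B′ i l))}} (C≤C′ l j))

  -- Action of integer matrices on real vectors

  -- Sends 0 and 1 to 0# and 1# definitionally, as the constants of the ring solver do.
  ⟦_⟧ : ℤ → Carrier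
  ⟦ + 0 ⟧ = 0#
  ⟦ + 1 ⟧ = 1#
  ⟦ z ⟧   = ι (ℤ→ℚ z)

  ⟦⟧≈ι : ∀ z → ⟦ z ⟧ ≈ ι (ℤ→ℚ z)
  ⟦⟧≈ι (+ 0)             = sym ι-0
  ⟦⟧≈ι (+ 1)             = sym ι-1
  ⟦⟧≈ι (+ suc (suc _))   = refl
  ⟦⟧≈ι ℤ.-[1+ _ ]        = refl

  ⟦⟧-+ : ∀ y z → ⟦ y ℤ.+ z ⟧ ≈ ⟦ y ⟧ + ⟦ z ⟧
  ⟦⟧-+ y z = begin
    ⟦ y ℤ.+ z ⟧                ≈⟨ ⟦⟧≈ι (y ℤ.+ z) ⟩
    ι (ℤ→ℚ (y ℤ.+ z))          ≡⟨ ≡.cong ι (ℤ→ℚ-Homomorphism.+-homo y z) ⟩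
    ι (ℤ→ℚ y ℚ.+ ℤ→ℚ z)        ≈⟨ ι-+ _ _ ⟩
    ι (ℤ→ℚ y) + ι (ℤ→ℚ z)      ≈⟨ +-cong (⟦⟧≈ι y) (⟦⟧≈ι z) ⟨
    ⟦ y ⟧ + ⟦ z ⟧              ∎
    where open ≈-Reasoning

  ⟦⟧-* : ∀ y z → ⟦ y ℤ.* z ⟧ ≈ ⟦ y ⟧ * ⟦ z ⟧
  ⟦⟧-* y z = begin
    ⟦ y ℤ.* z ⟧                ≈⟨ ⟦⟧≈ι (y ℤ.* z) ⟩
    ι (ℤ→ℚ (y ℤ.* z))          ≡⟨ ≡.cong ι (ℤ→ℚ-Homomorphism.*-homo y z) ⟩
    ι (ℤ→ℚ y ℚ.* ℤ→ℚ z)        ≈⟨ ι-* _ _ ⟩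
    ι (ℤ→ℚ y) * ι (ℤ→ℚ z)      ≈⟨ *-cong (⟦⟧≈ι y) (⟦⟧≈ι z) ⟨
    ⟦ y ⟧ * ⟦ z ⟧              ∎
    where open ≈-Reasoning

  ⟦⟧-sum : ∀ {n} (a : Vector ℤ n) → ⟦ ℤ-sum a ⟧ ≈ sum (λ i → ⟦ a i ⟧)
  ⟦⟧-sum {zero}  a = refl
  ⟦⟧-sum {suc n} a = trans (⟦⟧-+ (a 0F) _) (+-congˡ (⟦⟧-sum (λ i → a (suc i))))

  infixr 7 _∙_
  _∙_ : Matrix → Vector Carrier 3 → Vector Carrier 3
  (B ∙ v) i = sum (λ j → ⟦ B i j ⟧ * v j)

  ∙-cong : ∀ B {v w} → (∀ i → v i ≈ w i) → ∀ i → (B ∙ v) i ≈ (B ∙ w) i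
  ∙-cong B v≈w i = sum-cong-≋ (λ j → *-congˡ {⟦ B i j ⟧} (v≈w j))

  ∙-congʳ : ∀ {B C} v → B ≐ C → ∀ i → (B ∙ v) i ≈ (C ∙ v) i
  ∙-congʳ v B≐C i = sum-cong-≋ (λ j → *-congʳ {v j} (reflexive (≡.cong ⟦_⟧ (B≐C i j))))

  ⊗-∙ : ∀ B C v i → ((B ⊗ C) ∙ v) i ≈ (B ∙ C ∙ v) i
  ⊗-∙ B C v i = trans
    (sum-cong-≋ (λ j → *-congʳ {v j} (trans (⟦⟧-sum (λ l → B i l ℤ.* C l j)) (sum-cong-≋ (λ l → ⟦⟧-* (B i l) (C l j))))))
    (sum-*-assoc semiring (λ l → ⟦ B i l ⟧) (λ l j → ⟦ C l j ⟧) v)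

  ∙-scale : ∀ B d v i → (B ∙ (λ j → d * v j)) i ≈ d * (B ∙ v) i
  ∙-scale B d v i = solve 7 (λ d a b c x y z →
      a :* (d :* x) :+ (b :* (d :* y) :+ (c :* (d :* z) :+ con 0ℤ)) := d :* (a :* x :+ (b :* y :+ (c :* z :+ con 0ℤ))))
    refl d ⟦ B i 0F ⟧ ⟦ B i 1F ⟧ ⟦ B i 2F ⟧ (v 0F) (v 1F) (v 2F)

  I-∙ : ∀ v i → (I ∙ v) i ≈ v i
  I-∙ v 0F = solve 3 (λ x y z → con 1ℤ :* x :+ (con 0ℤ :* y :+ (con 0ℤ :* z :+ con 0ℤ)) := x) refl (v 0F) (v 1F) (v 2F)
  I-∙ v 1F = solve 3 (λ x y z → con 0ℤ :* x :+ (con 1ℤ :* y :+ (con 0ℤ :* z :+ con 0ℤ)) := y) refl (v 0F) (v 1F) (v 2F)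
  I-∙ v 2F = solve 3 (λ x y z → con 0ℤ :* x :+ (con 0ℤ :* y :+ (con 1ℤ :* z :+ con 0ℤ)) := z) refl (v 0F) (v 1F) (v 2F)

  -- Elementary transvections

  -- A e = S E e S⁻¹ is A e in barycentric coordinates.  For e = (i , j) it is the
  -- transvection that adds coordinate j to coordinate i, and E⁻¹ e subtracts it.
  E E⁻¹ : Ind → Matrix
  E ⟨1,2⟩ = (1ℤ ∷ 0ℤ ∷ 0ℤ ∷ []) ∷ (0ℤ ∷ 1ℤ ∷ 1ℤ ∷ []) ∷ (0ℤ ∷ 0ℤ ∷ 1ℤ ∷ []) ∷ []
  E ⟨2,1⟩ = (1ℤ ∷ 0ℤ ∷ 0ℤ ∷ []) ∷ (0ℤ ∷ 1ℤ ∷ 0ℤ ∷ []) ∷ (0ℤ ∷ 1ℤ ∷ 1ℤ ∷ []) ∷ []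
  E ⟨0,1⟩ = (1ℤ ∷ 1ℤ ∷ 0ℤ ∷ []) ∷ (0ℤ ∷ 1ℤ ∷ 0ℤ ∷ []) ∷ (0ℤ ∷ 0ℤ ∷ 1ℤ ∷ []) ∷ []
  E ⟨1,0⟩ = (1ℤ ∷ 0ℤ ∷ 0ℤ ∷ []) ∷ (1ℤ ∷ 1ℤ ∷ 0ℤ ∷ []) ∷ (0ℤ ∷ 0ℤ ∷ 1ℤ ∷ []) ∷ []
  E ⟨0,2⟩ = (1ℤ ∷ 0ℤ ∷ 1ℤ ∷ []) ∷ (0ℤ ∷ 1ℤ ∷ 0ℤ ∷ []) ∷ (0ℤ ∷ 0ℤ ∷ 1ℤ ∷ []) ∷ []
  E ⟨2,0⟩ = (1ℤ ∷ 0ℤ ∷ 0ℤ ∷ []) ∷ (0ℤ ∷ 1ℤ ∷ 0ℤ ∷ []) ∷ (1ℤ ∷ 0ℤ ∷ 1ℤ ∷ []) ∷ []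

  E⁻¹ e i j = I i j ℤ.+ (I i j ℤ.- E e i j)

  -- The conjugation relation without `S⁻¹`; it carries `S` from the right end of the product
  -- defining `M` to the left end.
  A⊗S : ∀ e → A e ⊗ S ≐ S ⊗ E e
  A⊗S ⟨1,2⟩ = toWitness {a? = (A ⟨1,2⟩ ⊗ S) ≐? (S ⊗ E ⟨1,2⟩)} _
  A⊗S ⟨2,1⟩ = toWitness {a? = (A ⟨2,1⟩ ⊗ S) ≐? (S ⊗ E ⟨2,1⟩)} _
  A⊗S ⟨0,1⟩ = toWitness {a? = (A ⟨0,1⟩ ⊗ S) ≐? (S ⊗ E ⟨0,1⟩)} _
  A⊗S ⟨1,0⟩ = toWitness {a? = (A ⟨1,0⟩ ⊗ S) ≐? (S ⊗ E ⟨1,0⟩)} _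
  A⊗S ⟨0,2⟩ = toWitness {a? = (A ⟨0,2⟩ ⊗ S) ≐? (S ⊗ E ⟨0,2⟩)} _
  A⊗S ⟨2,0⟩ = toWitness {a? = (A ⟨2,0⟩ ⊗ S) ≐? (S ⊗ E ⟨2,0⟩)} _

  -- `E e - I` squares to zero, so `I - (E e - I)` inverts `E e`.
  E⊗E⁻¹ : ∀ e → E e ⊗ E⁻¹ e ≐ I
  E⊗E⁻¹ ⟨1,2⟩ = toWitness {a? = (E ⟨1,2⟩ ⊗ E⁻¹ ⟨1,2⟩) ≐? I} _
  E⊗E⁻¹ ⟨2,1⟩ = toWitness {a? = (E ⟨2,1⟩ ⊗ E⁻¹ ⟨2,1⟩) ≐? I} _
  E⊗E⁻¹ ⟨0,1⟩ = toWitness {a? = (E ⟨0,1⟩ ⊗ E⁻¹ ⟨0,1⟩) ≐? I} _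
  E⊗E⁻¹ ⟨1,0⟩ = toWitness {a? = (E ⟨1,0⟩ ⊗ E⁻¹ ⟨1,0⟩) ≐? I} _
  E⊗E⁻¹ ⟨0,2⟩ = toWitness {a? = (E ⟨0,2⟩ ⊗ E⁻¹ ⟨0,2⟩) ≐? I} _
  E⊗E⁻¹ ⟨2,0⟩ = toWitness {a? = (E ⟨2,0⟩ ⊗ E⁻¹ ⟨2,0⟩) ≐? I} _

  I≤E : ∀ e → I ≤ᴹ E e
  I≤E ⟨1,2⟩ = toWitness {a? = I ≤ᴹ? E ⟨1,2⟩} _
  I≤E ⟨2,1⟩ = toWitness {a? = I ≤ᴹ? E ⟨2,1⟩} _
  I≤E ⟨0,1⟩ = toWitness {a? = I ≤ᴹ? E ⟨0,1⟩} _
  I≤E ⟨1,0⟩ = toWitness {a? = I ≤ᴹ? E ⟨1,0⟩} _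
  I≤E ⟨0,2⟩ = toWitness {a? = I ≤ᴹ? E ⟨0,2⟩} _
  I≤E ⟨2,0⟩ = toWitness {a? = I ≤ᴹ? E ⟨2,0⟩} _

  O≤I : O ≤ᴹ I
  O≤I = toWitness {a? = O ≤ᴹ? I} _

  -- Barycentric coordinates and one step of the map

  barycentric : Point → Vector Carrier 3
  barycentric (x , y) = 1# - x - y ∷ x ∷ y ∷ []

  -- Thus `barycentric (x , y)` serves as `S⁻¹` applied to `(1 , x , y)`.
  S-barycentric : ∀ x y i → (S ∙ barycentric (x , y)) i ≈ (1# ∷ x ∷ y ∷ []) i
  S-barycentric x y 0F = solve 2 (λ x y → con 1ℤ :* (con 1ℤ :- x :- y) :+ (con 1ℤ :* x :+ (con 1ℤ :* y :+ con 0ℤ)) := con 1ℤ) refl x y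
  S-barycentric x y 1F = solve 2 (λ x y → con 0ℤ :* (con 1ℤ :- x :- y) :+ (con 1ℤ :* x :+ (con 0ℤ :* y :+ con 0ℤ)) := x) refl x y
  S-barycentric x y 2F = solve 2 (λ x y → con 0ℤ :* (con 1ℤ :- x :- y) :+ (con 0ℤ :* x :+ (con 1ℤ :* y :+ con 0ℤ)) := y) refl x y

  barycentric-pos : ∀ x i → 0# < barycentric (ΔK.point x) i
  barycentric-pos x 0F = ΔK.0<γ x
  barycentric-pos x 1F = ΔK.0<α x
  barycentric-pos x 2F = ΔK.0<β x

  -- The map before rescaling: the three entries add up to `denominator e x y`, which is therefore
  -- the factor that normalises them.
  E⁻¹-numerators : ∀ e x y i → let n₁ = numerator₁ e x y; n₂ = numerator₂ e x y in
    (E⁻¹ e ∙ barycentric (x , y)) i ≈ (denominator e x y - n₁ - n₂ ∷ n₁ ∷ n₂ ∷ []) i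
  E⁻¹-numerators e x y i = go e i
    where
    go : ∀ e i → (E⁻¹ e ∙ barycentric (x , y)) i ≈
         (denominator e x y - numerator₁ e x y - numerator₂ e x y ∷ numerator₁ e x y ∷ numerator₂ e x y ∷ []) i
    -- Each left-hand side is a row of `E⁻¹ e` written exactly as `_∙_` unfolds, with the trailing
    -- zero of `sum`.
    go ⟨1,2⟩ 0F = solve 2 (λ x y → con 1ℤ :* (con 1ℤ :- x :- y) :+ (con 0ℤ :* x :+ (con 0ℤ :* y :+ con 0ℤ)) := con 1ℤ :- y :- (x :- y) :- y) refl x y
    go ⟨1,2⟩ 1F = solve 2 (λ x y → con 0ℤ :* (con 1ℤ :- x :- y) :+ (con 1ℤ :* x :+ (con -1ℤ :* y :+ con 0ℤ)) := x :- y) refl x y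
    go ⟨1,2⟩ 2F = solve 2 (λ x y → con 0ℤ :* (con 1ℤ :- x :- y) :+ (con 0ℤ :* x :+ (con 1ℤ :* y :+ con 0ℤ)) := y) refl x y
    go ⟨2,1⟩ 0F = solve 2 (λ x y → con 1ℤ :* (con 1ℤ :- x :- y) :+ (con 0ℤ :* x :+ (con 0ℤ :* y :+ con 0ℤ)) := con 1ℤ :- x :- x :- (y :- x)) refl x y
    go ⟨2,1⟩ 1F = solve 2 (λ x y → con 0ℤ :* (con 1ℤ :- x :- y) :+ (con 1ℤ :* x :+ (con 0ℤ :* y :+ con 0ℤ)) := x) refl x y
    go ⟨2,1⟩ 2F = solve 2 (λ x y → con 0ℤ :* (con 1ℤ :- x :- y) :+ (con -1ℤ :* x :+ (con 1ℤ :* y :+ con 0ℤ)) := y :- x) refl x y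
    go ⟨0,1⟩ 0F = solve 2 (λ x y → con 1ℤ :* (con 1ℤ :- x :- y) :+ (con -1ℤ :* x :+ (con 0ℤ :* y :+ con 0ℤ)) := con 1ℤ :- x :- x :- y) refl x y
    go ⟨0,1⟩ 1F = solve 2 (λ x y → con 0ℤ :* (con 1ℤ :- x :- y) :+ (con 1ℤ :* x :+ (con 0ℤ :* y :+ con 0ℤ)) := x) refl x y
    go ⟨0,1⟩ 2F = solve 2 (λ x y → con 0ℤ :* (con 1ℤ :- x :- y) :+ (con 0ℤ :* x :+ (con 1ℤ :* y :+ con 0ℤ)) := y) refl x y
    go ⟨1,0⟩ 0F = solve 2 (λ x y → con 1ℤ :* (con 1ℤ :- x :- y) :+ (con 0ℤ :* x :+ (con 0ℤ :* y :+ con 0ℤ)) := x :+ y :- (x :+ x :+ y :- con 1ℤ) :- y) refl x y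
    go ⟨1,0⟩ 1F = solve 2 (λ x y → con -1ℤ :* (con 1ℤ :- x :- y) :+ (con 1ℤ :* x :+ (con 0ℤ :* y :+ con 0ℤ)) := x :+ x :+ y :- con 1ℤ) refl x y
    go ⟨1,0⟩ 2F = solve 2 (λ x y → con 0ℤ :* (con 1ℤ :- x :- y) :+ (con 0ℤ :* x :+ (con 1ℤ :* y :+ con 0ℤ)) := y) refl x y
    go ⟨0,2⟩ 0F = solve 2 (λ x y → con 1ℤ :* (con 1ℤ :- x :- y) :+ (con 0ℤ :* x :+ (con -1ℤ :* y :+ con 0ℤ)) := con 1ℤ :- y :- x :- y) refl x y
    go ⟨0,2⟩ 1F = solve 2 (λ x y → con 0ℤ :* (con 1ℤ :- x :- y) :+ (con 1ℤ :* x :+ (con 0ℤ :* y :+ con 0ℤ)) := x) refl x y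
    go ⟨0,2⟩ 2F = solve 2 (λ x y → con 0ℤ :* (con 1ℤ :- x :- y) :+ (con 0ℤ :* x :+ (con 1ℤ :* y :+ con 0ℤ)) := y) refl x y
    go ⟨2,0⟩ 0F = solve 2 (λ x y → con 1ℤ :* (con 1ℤ :- x :- y) :+ (con 0ℤ :* x :+ (con 0ℤ :* y :+ con 0ℤ)) := x :+ y :- x :- (x :+ (y :+ y) :- con 1ℤ)) refl x y
    go ⟨2,0⟩ 1F = solve 2 (λ x y → con 0ℤ :* (con 1ℤ :- x :- y) :+ (con 1ℤ :* x :+ (con 0ℤ :* y :+ con 0ℤ)) := x) refl x y
    go ⟨2,0⟩ 2F = solve 2 (λ x y → con -1ℤ :* (con 1ℤ :- x :- y) :+ (con 0ℤ :* x :+ (con 1ℤ :* y :+ con 0ℤ)) := x :+ (y :+ y) :- con 1ℤ) refl x y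

  -- Clears the denominators of `T⟨ e ⟩ x`; the factor stays in front, since only its positivity
  -- will matter.
  T-barycentric : ∀ e x x∈△ i → (E⁻¹ e ∙ barycentric (ΔK.point x)) i ≈
    denominator e (ΔK.α x) (ΔK.β x) * barycentric (ΔK.point (T⟨ e ⟩ x x∈△)) i
  T-barycentric e x x∈△ i = trans (E⁻¹-numerators e α β i) (go i)
    where
    open ΔK x
    d = denominator e α β
    n₁ = numerator₁ e α β
    n₂ = numerator₂ e α β
    0<d = 0<denominator e x
    n≈ : ∀ n → n ≈ d * (n ÷ d [ 0<d ])
    n≈ n = trans (sym (÷-* n 0<d)) (*-comm _ d)
    go : ∀ i → (d - n₁ - n₂ ∷ n₁ ∷ n₂ ∷ []) i ≈ d * barycentric (n₁ ÷ d [ 0<d ] , n₂ ÷ d [ 0<d ]) i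
    go 0F = trans (+-cong (+-congˡ (-‿cong (n≈ n₁))) (-‿cong (n≈ n₂)))
      (solve 3 (λ d a b → d :- d :* a :- d :* b := d :* (con 1ℤ :- a :- b)) refl d _ _)
    go 1F = n≈ n₁
    go 2F = n≈ n₂

  -- Positivity of affine forms near a point

  ∙-barycentric : ∀ B x y u v j → (B ∙ barycentric (u , v)) j ≈ (B ∙ barycentric (x , y)) j +
    ((⟦ B j 1F ⟧ - ⟦ B j 0F ⟧) * (u - x) + (⟦ B j 2F ⟧ - ⟦ B j 0F ⟧) * (v - y))
  ∙-barycentric B x y u v j = solve 7 (λ a b c x y u v →
      a :* (con 1ℤ :- u :- v) :+ (b :* u :+ (c :* v :+ con 0ℤ))
      := a :* (con 1ℤ :- x :- y) :+ (b :* x :+ (c :* y :+ con 0ℤ)) :+ ((b :- a) :* (u :- x) :+ (c :- a) :* (v :- y)))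
    refl ⟦ B j 0F ⟧ ⟦ B j 1F ⟧ ⟦ B j 2F ⟧ x y u v

  -- By `∙-barycentric` each row is an affine form, equal to its first-order expansion at `(x , y)`.
  -- Each stays nonnegative on a disc, and a radius below all three serves them together.
  barycentric-interior : ∀ B {x y} → (∀ j → 0# < (B ∙ barycentric (x , y)) j) →
    (x , y) ∈ interior (λ z → ∀ j → 0# ≤ (B ∙ barycentric z) j)
  barycentric-interior B {x} {y} pos = r , 0<r , nonNeg
    where
    half : ∀ j → ∃[ ρ ] 0# < ρ × (∀ a b → a ^ 2 + b ^ 2 < ρ ^ 2 → 0# ≤ (B ∙ barycentric (x , y)) j +
      ((⟦ B j 1F ⟧ - ⟦ B j 0F ⟧) * a + (⟦ B j 2F ⟧ - ⟦ B j 0F ⟧) * b))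
    half j = affine-nonNeg-near _ _ (pos j)
    bound = positive-lowerBound (λ j → proj₁ (half j)) (λ j → proj₁ (proj₂ (half j)))
    r = proj₁ bound
    0<r = proj₁ (proj₂ bound)
    nonNeg : ∀ u v → (u - x) ^ 2 + (v - y) ^ 2 < r ^ 2 → ∀ j → 0# ≤ (B ∙ barycentric (u , v)) j
    nonNeg u v near j neg = proj₂ (proj₂ (half j)) (u - x) (v - y)
      (<.trans near (^-mono-< 0<r (proj₂ (proj₂ bound) j) 2))
      (<-respˡ (∙-barycentric B x y u v j) neg)

  -- Convex combinations of the vertices

  ι-÷ : ∀ s t .{{_ : ℚ.NonZero t}} → ι t * ι (s ℚ.÷ t) ≈ ι s
  ι-÷ s t = trans (sym (ι-* t (s ℚ.÷ t))) (reflexive (≡.cong ι (begin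
    t ℚ.* (s ℚ.* ℚ.1/ t)   ≡⟨ ℚ.*-comm t _ ⟩
    s ℚ.* ℚ.1/ t ℚ.* t     ≡⟨ ℚ.*-assoc s (ℚ.1/ t) t ⟩
    s ℚ.* (ℚ.1/ t ℚ.* t)   ≡⟨ ≡.cong (s ℚ.*_) (ℚ.*-inverseˡ t) ⟩
    s ℚ.* ℚ.1ℚ             ≡⟨ ℚ.*-identityʳ s ⟩
    s                      ∎)))
    where open ≡.≡-Reasoning

  ℤ→ℚ-positive : ∀ {z} → 0ℤ ℤ.< z → ℚ.Positive (ℤ→ℚ z)
  ℤ→ℚ-positive {+ suc n} _ = ℚ.normalize-pos (suc n) 1
  ℤ→ℚ-positive {+ zero} (ℤ.+<+ ())

  -- The weights are `C 0F j * w j`. Row `0F` of the hypothesis says that they add up to 1, and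
  -- multiplying by the vertex coordinate `C i j / C 0F j` turns them into the terms of row `i`.
  column-triangle : ∀ C → (0<C₀ : ∀ j → 0ℤ ℤ.< C 0F j) → ∀ {x y} w → (∀ j → 0# ≤ w j) →
    (∀ i → (C ∙ w) i ≈ (1# ∷ x ∷ y ∷ []) i) →
    (x , y) ∈ triangle (λ j → let instance _ = ℚ.pos⇒nonZero (ℤ→ℚ (C 0F j)) {{ℤ→ℚ-positive (0<C₀ j)}} in
      ι (ℤ→ℚ (C 1F j) ℚ.÷ ℤ→ℚ (C 0F j)) , ι (ℤ→ℚ (C 2F j) ℚ.÷ ℤ→ℚ (C 0F j)))
  column-triangle C 0<C₀ w 0≤w C∙w≈ = (λ j → ⟦ C 0F j ⟧ * w j) , weight-nonNeg , C∙w≈ 0F ,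
      trans (sym (C∙w≈ 1F)) (sum-cong-≋ (λ j → term 1F j)) , trans (sym (C∙w≈ 2F)) (sum-cong-≋ (λ j → term 2F j))
    where
    instance
      C₀≢0 : ∀ {j} → ℚ.NonZero (ℤ→ℚ (C 0F j))
      C₀≢0 {j} = ℚ.pos⇒nonZero (ℤ→ℚ (C 0F j)) {{ℤ→ℚ-positive (0<C₀ j)}}
    weight-nonNeg : ∀ j → 0# ≤ ⟦ C 0F j ⟧ * w j
    weight-nonNeg j = *-nonNeg (<-respʳ (sym (⟦⟧≈ι (C 0F j)))
      (ι-pos (ℚ.positive⁻¹ _ {{ℤ→ℚ-positive (0<C₀ j)}}))) (0≤w j)
    term : ∀ i j → ⟦ C i j ⟧ * w j ≈ ⟦ C 0F j ⟧ * w j * ι (ℤ→ℚ (C i j) ℚ.÷ ℤ→ℚ (C 0F j))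
    term i j = sym (begin
      ⟦ C 0F j ⟧ * w j * s            ≈⟨ *-congʳ (*-congʳ (⟦⟧≈ι (C 0F j))) ⟩
      ι (ℤ→ℚ (C 0F j)) * w j * s      ≈⟨ solve 3 (λ p w s → p :* w :* s := p :* s :* w) refl _ (w j) s ⟩
      ι (ℤ→ℚ (C 0F j)) * s * w j      ≈⟨ *-congʳ (ι-÷ (ℤ→ℚ (C i j)) (ℤ→ℚ (C 0F j))) ⟩
      ι (ℤ→ℚ (C i j)) * w j           ≈⟨ *-congʳ (⟦⟧≈ι (C i j)) ⟨
      ⟦ C i j ⟧ * w j                 ∎)
      where
      open ≈-Reasoning
      s = ι (ℤ→ℚ (C i j) ℚ.÷ ℤ→ℚ (C 0F j))

  -- The matrices after `n` steps

  module _ (p q : ℕ) .{{_ : NonZero q}} where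
    open Algorithm ℝ 𝕂 p q using (ε; ε-spec; T; M; δ)

    -- Recursion peels off the first step and moves on to `T x`, as `M` does; the inverse collects
    -- its factors in reverse order.
    P P⁻¹ : ℕ → ΔK → Matrix
    P zero    x = I
    P (suc n) x = E (ε x) ⊗ P n (T x)

    P⁻¹ zero    x = I
    P⁻¹ (suc n) x = P⁻¹ n (T x) ⊗ E⁻¹ (ε x)

    M≐S⊗P : ∀ n x → M x n ≐ S ⊗ P n x
    M≐S⊗P zero    x i j = toWitness {a? = S ≐? (S ⊗ I)} _ i j
    M≐S⊗P (suc n) x i j = begin
      -- Equal to `M x (suc n) i j` by definition, as `iterate T x (suc i)` unfolds to
      -- `iterate T (T x) i`.
      (A e ⊗ M (T x) n) i j       ≡⟨ ⊗-congˡ (A e) (M≐S⊗P n (T x)) i j ⟩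
      (A e ⊗ (S ⊗ Q)) i j         ≡⟨ ⊗-assoc (A e) S Q i j ⟨
      ((A e ⊗ S) ⊗ Q) i j         ≡⟨ ⊗-congʳ Q (A⊗S e) i j ⟩
      ((S ⊗ E e) ⊗ Q) i j         ≡⟨ ⊗-assoc S (E e) Q i j ⟩
      (S ⊗ (E e ⊗ Q)) i j         ∎
      where
      open ≡.≡-Reasoning
      e = ε x
      Q = P n (T x)

    -- Products of nonnegative matrices are monotone, and `I ⊗ I ≐ I`.
    I≤P : ∀ n x → I ≤ᴹ P n x
    I≤P zero    x i j = ℤ.≤-refl
    I≤P (suc n) x i j = ≡.subst (ℤ._≤ P (suc n) x i j) (toWitness {a? = (I ⊗ I) ≐? I} _ i j)
      (⊗-mono-≤ O≤I (I≤E (ε x)) O≤I (I≤P n (T x)) i j)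

    -- From `M = S P` and `I ≤ P`. The first row of `S` consists of ones, so the vertex denominators
    -- are at least 1.
    S≤M : ∀ n x → S ≤ᴹ M x n
    S≤M n x i j = ≡.subst₂ ℤ._≤_ (toWitness {a? = (S ⊗ I) ≐? S} _ i j) (≡.sym (M≐S⊗P n x i j))
      (⊗-mono-≤ (toWitness {a? = O ≤ᴹ? S} _) (λ i j → ℤ.≤-refl {S i j}) O≤I (I≤P n x) i j)

    0<M₀ : ∀ n x j → 0ℤ ℤ.< M x n 0F j
    0<M₀ n x 0F = ℤ.<-≤-trans (ℤ.+<+ (ℕ.s≤s ℕ.z≤n)) (S≤M n x 0F 0F)
    0<M₀ n x 1F = ℤ.<-≤-trans (ℤ.+<+ (ℕ.s≤s ℕ.z≤n)) (S≤M n x 0F 1F)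
    0<M₀ n x 2F = ℤ.<-≤-trans (ℤ.+<+ (ℕ.s≤s ℕ.z≤n)) (S≤M n x 0F 2F)

    -- The product telescopes from the middle: the inner factors cancel by induction at `T x`, then
    -- `E e` meets `E⁻¹ e`.
    P∙P⁻¹ : ∀ n x v i → (P n x ∙ P⁻¹ n x ∙ v) i ≈ v i
    P∙P⁻¹ zero    x v i = trans (I-∙ (I ∙ v) i) (I-∙ v i)
    P∙P⁻¹ (suc n) x v i = begin
      ((E e ⊗ Q) ∙ (Q⁻¹ ⊗ E⁻¹ e) ∙ v) i      ≈⟨ ⊗-∙ (E e) Q ((Q⁻¹ ⊗ E⁻¹ e) ∙ v) i ⟩
      (E e ∙ Q ∙ (Q⁻¹ ⊗ E⁻¹ e) ∙ v) i        ≈⟨ ∙-cong (E e) (∙-cong Q (⊗-∙ Q⁻¹ (E⁻¹ e) v)) i ⟩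
      (E e ∙ Q ∙ Q⁻¹ ∙ E⁻¹ e ∙ v) i          ≈⟨ ∙-cong (E e) (P∙P⁻¹ n (T x) (E⁻¹ e ∙ v)) i ⟩
      (E e ∙ E⁻¹ e ∙ v) i                    ≈⟨ ⊗-∙ (E e) (E⁻¹ e) v i ⟨
      ((E e ⊗ E⁻¹ e) ∙ v) i                  ≈⟨ ∙-congʳ v (E⊗E⁻¹ e) i ⟩
      (I ∙ v) i                              ≈⟨ I-∙ v i ⟩
      v i                                    ∎
      where
      open ≈-Reasoning
      e = ε x
      Q = P n (T x)
      Q⁻¹ = P⁻¹ n (T x)

    -- Each `E⁻¹` passes to the coordinates of the next iterate times a positive denominator, and
    -- every iterate lies in `ΔK`, where all three coordinates are positive.
    P⁻¹-pos : ∀ n x j → 0# < (P⁻¹ n x ∙ barycentric (ΔK.point x)) j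
    P⁻¹-pos zero    x j = <-respʳ (sym (I-∙ (barycentric (ΔK.point x)) j)) (barycentric-pos x j)
    P⁻¹-pos (suc n) x j = <-respʳ (sym (begin
      ((Q⁻¹ ⊗ E⁻¹ e) ∙ b) j            ≈⟨ ⊗-∙ Q⁻¹ (E⁻¹ e) b j ⟩
      (Q⁻¹ ∙ E⁻¹ e ∙ b) j              ≈⟨ ∙-cong Q⁻¹ (T-barycentric e x (proj₂ (proj₂ (ε-spec x)))) j ⟩
      (Q⁻¹ ∙ (λ i → d * b′ i)) j       ≈⟨ ∙-scale Q⁻¹ d b′ j ⟩
      d * (Q⁻¹ ∙ b′) j                 ∎)) (*-pos (0<denominator e x) (P⁻¹-pos n (T x) j))
      where
      open ≈-Reasoning
      e = ε x
      Q⁻¹ = P⁻¹ n (T x)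
      b = barycentric (ΔK.point x)
      b′ = barycentric (ΔK.point (T x))
      d = denominator e (ΔK.α x) (ΔK.β x)

    -- Valid at every `(u , v)`, not just at the given point, so the same formula supplies weights
    -- throughout the disc.
    M∙P⁻¹ : ∀ n x u v i → (M x n ∙ P⁻¹ n x ∙ barycentric (u , v)) i ≈ (1# ∷ u ∷ v ∷ []) i
    M∙P⁻¹ n x u v i = begin
      (M x n ∙ P⁻¹ n x ∙ b) i          ≈⟨ ∙-congʳ (P⁻¹ n x ∙ b) (M≐S⊗P n x) i ⟩
      ((S ⊗ P n x) ∙ P⁻¹ n x ∙ b) i    ≈⟨ ⊗-∙ S (P n x) (P⁻¹ n x ∙ b) i ⟩
      (S ∙ P n x ∙ P⁻¹ n x ∙ b) i      ≈⟨ ∙-cong S (P∙P⁻¹ n x b) i ⟩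
      (S ∙ b) i                        ≈⟨ S-barycentric u v i ⟩
      (1# ∷ u ∷ v ∷ []) i              ∎
      where
      open ≈-Reasoning
      b = barycentric (u , v)

    point∈δ : ∀ n x → ΔK.point x ∈ δ n x
    point∈δ n x =
      let ρ , 0<ρ , nonNeg = barycentric-interior (P⁻¹ n x) (P⁻¹-pos n x)
      in (λ j → ℚ.pos⇒nonZero (ℤ→ℚ (M x n 0F j)) {{ℤ→ℚ-positive (0<M₀ n x j)}}) , ρ , 0<ρ , λ u v near →
           column-triangle (M x n) (0<M₀ n x) (P⁻¹ n x ∙ barycentric (u , v)) (nonNeg u v near) (M∙P⁻¹ n x u v)

open NumberField using (ΔK; module ΔK)
open Algorithm using (δ)

theorem2p5 : ∀ {c ℓ₁ ℓ₂ k} (ℝ : RealNumbers c ℓ₁ ℓ₂) (𝕂 : CubicField ℝ k)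
    (p q : ℕ) .{{_ : NonZero p}} .{{_ : NonZero q}} → Coprime p q → ¬ (3 ∣ p) →
    (x : ΔK ℝ 𝕂) (n : ℕ) → ΔK.point x ∈ δ ℝ 𝕂 p q n x
theorem2p5 ℝ 𝕂 p q _ _ x n = Barycentric.point∈δ ℝ 𝕂 p q n x
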